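{- Let $n>63$ be an integer. Then \[ m(1,J(n,3))=\begin{cases}4, & n \text{ even},\\ 6, & n \text{ odd and } n\equiv 0 \text{ or } 6 \pmod 9,\\ 7, & \text{otherwise}.\end{cases} \]
   Context: For integers $1\le k<n$, the Johnson graph $J(n,k)$ has as vertices the $k$-subsets of $\{1,\dots,n\}$, two subsets being adjacent when they meet in a $(k-1)$-subset. Its distinct eigenvalues are indexed in decreasing order $\theta_0>\theta_1>\dots>\theta_k$; in particular $\theta_1(J(n,k))=(k-1)(n-k-1)-1$ is the second largest eigenvalue. A vector is a $\theta$-eigenvector of a graph if it is nonzero and $Av=\theta v$ for the adjacency matrix $A$. A vector is nowhere-zero integer (NZI) if all its entries are nonzero integers, and $\|v\|_\infty=\max_x|v_x|$. For a graph $\Gamma$ and eigenvalue $\theta_i(\Gamma)$, $m(i,\Gamma)=\min\{\|u\|_\infty+1: u \text{ is an NZI } \theta_i(\Gamma)\text{ -eigenvector of }\Gamma\}$. -}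

module Defs where

import Data.Nat as ℕ
open ℕ using (ℕ; zero; suc; _⊔_; _%_; _∸_)
import Data.Integer as ℤ
open ℤ using (ℤ; +_)
open import Data.Fin.Subset using (Subset; inside; outside; ∣_∣; _∩_)
open import Data.Vec using (_∷_; [])
open import Data.Product using (Σ; ∃; _×_; _,_)
open import Relation.Binary.PropositionalEquality using (_≡_; _≢_)
open import Relation.Nullary using (yes; no)

foldSub : {A : Set} → (A → A → A) → {n : ℕ} → (Subset n → A) → A
foldSub _∙_ {zero}  f = f []
foldSub _∙_ {suc n} f = foldSub _∙_ (λ s → f (inside ∷ s)) ∙ foldSub _∙_ (λ s → f (outside ∷ s))

Vertex : ℕ → ℕ → Set
Vertex n k = Σ (Subset n) (λ s → ∣ s ∣ ≡ k)

sumV : (n k : ℕ) → (Vertex n k → ℤ) → ℤ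
sumV n k f = foldSub ℤ._+_ g
  where
  g : Subset n → ℤ
  g s with ∣ s ∣ ℕ.≟ k
  ... | yes p = f (s , p)
  ... | no _  = + 0

Adj : (n k : ℕ) → Vertex n k → Vertex n k → Set
Adj n k (s , _) (t , _) = ∣ s ∩ t ∣ ≡ k ∸ 1

adjApply : (n k : ℕ) → (Vertex n k → ℤ) → Vertex n k → ℤ
adjApply n k u (s , p) = sumV n k h
  where
  h : Vertex n k → ℤ
  h (t , q) with ∣ s ∩ t ∣ ℕ.≟ k ∸ 1
  ... | yes _ = u (t , q)
  ... | no _  = + 0

IsEigenvector : (n k : ℕ) → ℤ → (Vertex n k → ℤ) → Set
IsEigenvector n k θ v =
  (∃ λ x → v x ≢ + 0) × (∀ x → adjApply n k v x ≡ θ ℤ.* v x)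

NowhereZero : (n k : ℕ) → (Vertex n k → ℤ) → Set
NowhereZero n k v = ∀ x → v x ≢ + 0

-- ‖v‖∞ = max_x |v_x|  (max over the vertex set; 0 if empty)
supNorm : (n k : ℕ) → (Vertex n k → ℤ) → ℕ
supNorm n k v = foldSub _⊔_ g
  where
  g : Subset n → ℕ
  g s with ∣ s ∣ ℕ.≟ k
  ... | yes p = ℤ.∣ v (s , p) ∣
  ... | no _  = 0

-- θ_1(J(n,k)) = (k-1)(n-k-1) - 1, the second largest eigenvalue (for 1 ≤ k < n)
theta1 : ℕ → ℕ → ℤ
theta1 n k = (+ ((k ∸ 1) ℕ.* (n ∸ k ∸ 1))) ℤ.- + 1

M1Is : (n k : ℕ) → ℕ → Set
M1Is n k m =
  (∃ λ u → NowhereZero n k u × IsEigenvector n k (theta1 n k) u × supNorm n k u ℕ.+ 1 ≡ m)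
  × (∀ u → NowhereZero n k u → IsEigenvector n k (theta1 n k) u → m ℕ.≤ supNorm n k u ℕ.+ 1)

expectedM : ℕ → ℕ
expectedM n with n % 2 ℕ.≟ 0
... | yes _ = 4
... | no _ with n % 9 ℕ.≟ 0 | n % 9 ℕ.≟ 6
...   | yes _ | _     = 6
...   | no _  | yes _ = 6
...   | no _  | no _  = 7

{-# OPTIONS --safe #-}
module Submission where

-- The θ₁-eigenvectors of J(n,3) are the vectors v(T) = Σ_{i ∈ T} aᵢ with Σ aᵢ = 0.  Indeed, with
-- P_{ij} the sum of v over the triples through i, j and Rᵢ = Σⱼ P_{ij}, the eigenvalue equation reads
-- (2n - 6) v(ijk) = P_{ij} + P_{ik} + P_{jk}; summing over k gives (n - 2) P_{ij} = Rᵢ + Rⱼ, and summing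
-- again Σ Rᵢ = 0.  If v is integral then bᵢ = 3aᵢ are integers, congruent modulo 3.
--
-- Suppose 0 < |v| ≤ 5.  As n > 63 and Σ bᵢ = 0, some t < 0 and some s > 0 are each taken by at least three
-- bᵢ ("heavy" values), and |t|, |s| ≤ 5, t ≡ s mod 3, 2t + s ≠ 0 ≠ t + 2s.  Up to sign (t, s) is (-5, 1),
-- (-3, 3) or (-5, 4), so |v| ≥ 3.  Combining any bₓ with t and s shows in the first two cases that all bₓ
-- agree modulo 6 with an odd number, so n is even, and in the last case that bₓ ∈ {-5, 4} for all x with
-- at most one exception in {-2, 7}, so n ≡ 0 or 6 mod 9.

-- Three points with bᵢ = t give an entry v = t, because their sum is 3t. So a heavy value satisfies
-- |t| ≤ 5 and is itself a lower bound for the norm. Three is also the number that leaves two points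
-- of value t, whichever x is set aside, so that every bₓ can be tested against 2t, t + s and 2s.
-- The one threshold 5 serves all three cases: no case needs a norm above 6, and beyond 5 the norm
-- is at least 6 anyway. The congruences come from Σ bᵢ = 0. If all bₓ = c + 6kₓ with c odd, then nc
-- is even, hence so is n. If bₓ = -5 + 9kₓ + 3eₓ with eₓ = 1 at most once and 0 elsewhere, then 5n
-- ≡ 3 Σ e mod 9, that is n ≡ 6 Σ e with Σ e either 0 or 1. The surviving configurations dictate the
-- examples: b = ±3 is a = ±1, and -5, 4, 7 are three times the coordinates -5/3, 4/3, 7/3.

open import Defs
open import Data.Bool using (Bool; true; false; not)
open import Data.Empty using (⊥-elim)
open import Data.Fin as F using (Fin; zero; suc)
open import Data.Fin.Patterns using (0F; 1F; 2F; 3F; 4F; 5F; 6F)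
import Data.Fin.Properties as Fₚ
open import Data.Fin.Subset using (Subset; inside; outside; ∣_∣; _∩_)
open import Data.Fin.Subset.Properties using (∣p∩q∣≤∣p∣; ∣p∩q∣≤∣q∣; ∣⊥∣≡0)
open import Data.Integer as ℤ using (ℤ; +_; -[1+_]; 0ℤ; 1ℤ; _+_; _*_; -_; _-_; _≤_)
import Data.Integer.Properties as ℤₚ
open import Data.Integer.Tactic.RingSolver using (solve-∀)
open import Data.List as L using (List; []; _∷_; length)
import Data.List.Membership.DecPropositional as DecMem
open import Data.List.Membership.Propositional using (_∈_)
open import Data.List.Relation.Unary.All as All using (All; []; _∷_; all?)
import Data.List.Relation.Unary.All.Properties as Allₚ
open import Data.List.Relation.Unary.Any using (index; here; there)
import Data.List.Relation.Unary.Any.Properties as Anyₚ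
open import Data.Nat as ℕ using (ℕ; zero; suc; _≡ᵇ_; _%_; _<_)
import Data.Nat.DivMod as DM
import Data.Nat.Properties as ℕₚ
open import Data.Nat.Tactic.RingSolver using () renaming (solve-∀ to ℕ-solve-∀)
open import Data.Product using (∃; ∃₂; _×_; _,_; proj₁; proj₂; map₂)
open import Data.Sum using (_⊎_; inj₁; inj₂; [_,_]′)
open import Data.Vec using ([]; _∷_; lookup; _[_]≔_; replicate)
open import Data.Vec.Properties
  using ([]≔-commutes; []≔-idempotent; []≔-lookup; lookup∘update; lookup∘update′; lookup-replicate)
open import Function using (_∘_)
open import Relation.Binary.PropositionalEquality
  using (_≡_; _≢_; refl; sym; trans; cong; cong₂; subst; module ≡-Reasoning)
open import Relation.Nullary using (Dec; yes; no; ¬_; ¬?)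
open import Relation.Nullary.Decidable using (decidable-stable; from-no; from-yes; _×-dec_)
open import Algebra.Properties.Semiring.Sum ℤₚ.+-*-semiring
  using (sum; sum-cong-≗; ∑-distrib-+; *-distribˡ-sum; sum-replicate-zero)

-- Sums over subsets exchanging one element of T

when : Bool → ℤ → ℤ
when true  z = z
when false z = 0ℤ

when-+ : ∀ b x y → when b (x + y) ≡ when b x + when b y
when-+ true  x y = refl
when-+ false x y = refl

≡ᵇ-false : ∀ {m n} → m ≢ n → (m ≡ᵇ n) ≡ false
≡ᵇ-false {zero}  {zero}  m≢n = ⊥-elim (m≢n refl)
≡ᵇ-false {zero}  {suc n} m≢n = refl
≡ᵇ-false {suc m} {zero}  m≢n = refl
≡ᵇ-false {suc m} {suc n} m≢n = ≡ᵇ-false (m≢n ∘ cong suc)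

sum-zero : ∀ {n} (f : Fin n → ℤ) → (∀ i → f i ≡ 0ℤ) → sum f ≡ 0ℤ
sum-zero {n} f f≡0 = trans (sum-cong-≗ f≡0) (sum-replicate-zero n)

foldSub-cong : {A : Set} (_∙_ : A → A → A) → ∀ {n} {f g : Subset n → A} →
               (∀ U → f U ≡ g U) → foldSub _∙_ f ≡ foldSub _∙_ g
foldSub-cong _∙_ {zero}  f≗g = f≗g []
foldSub-cong _∙_ {suc n} f≗g =
  cong₂ _∙_ (foldSub-cong _∙_ (f≗g ∘ (inside ∷_))) (foldSub-cong _∙_ (f≗g ∘ (outside ∷_)))

foldSub-zero : ∀ {n} (f : Subset n → ℤ) → (∀ U → f U ≡ 0ℤ) → foldSub _+_ f ≡ 0ℤ
foldSub-zero {zero}  f f≡0 = f≡0 []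
foldSub-zero {suc n} f f≡0 =
  cong₂ _+_ (foldSub-zero _ (f≡0 ∘ (inside ∷_))) (foldSub-zero _ (f≡0 ∘ (outside ∷_)))

-- The conditions are Booleans because `suc m ≡ᵇ suc n` reduces to `m ≡ᵇ n`: splitting off the head
-- of a subset then leaves sums of the same kind.
∑⟨_,_⟩ : ∀ {n} (size meet : Subset n → Bool) → (Subset n → ℤ) → ℤ
∑⟨ size , meet ⟩ F = foldSub _+_ λ U → when (size U) (when (meet U) (F U))

∑-empty : ∀ {n} (size meet : Subset n → ℕ) (a b : ℕ) (F : Subset n → ℤ) →
          (∀ U → size U ≡ a → meet U ≢ b) →
          ∑⟨ (λ U → size U ≡ᵇ a) , (λ U → meet U ≡ᵇ b) ⟩ F ≡ 0ℤ
∑-empty size meet a b F disjoint = foldSub-zero _ λ U → go U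
  where
  go : ∀ U → when (size U ≡ᵇ a) (when (meet U ≡ᵇ b) (F U)) ≡ 0ℤ
  go U with size U ℕ.≟ a
  ... | no  s≢a rewrite ≡ᵇ-false s≢a = refl
  ... | yes s≡a rewrite ≡ᵇ-false (disjoint U s≡a) with size U ≡ᵇ a
  ...   | true  = refl
  ...   | false = refl

∑-same : ∀ {n} (T : Subset n) F →
         ∑⟨ (λ U → ∣ U ∣ ≡ᵇ ∣ T ∣) , (λ U → ∣ T ∩ U ∣ ≡ᵇ ∣ T ∣) ⟩ F ≡ F T
∑-same []            F = refl
∑-same (inside ∷ T)  F = trans
  (cong₂ _+_ (∑-same T (F ∘ (inside ∷_)))
             (∑-empty ∣_∣ (λ U → ∣ T ∩ U ∣) _ _ _ λ U _ e → ℕₚ.<⇒≢ (ℕ.s≤s (∣p∩q∣≤∣p∣ T U)) e))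
  (ℤₚ.+-identityʳ _)
∑-same (outside ∷ T) F = trans
  (cong₂ _+_ (∑-empty (λ U → suc ∣ U ∣) (λ U → ∣ T ∩ U ∣) ∣ T ∣ ∣ T ∣ (F ∘ (inside ∷_))
                (λ U s e → ℕₚ.<⇒≢ (ℕ.s≤s (∣p∩q∣≤∣q∣ T U)) (trans e (sym s))))
             (∑-same T (F ∘ (outside ∷_))))
  (ℤₚ.+-identityˡ _)

∑-add : ∀ {n} (T : Subset n) F →
        ∑⟨ (λ U → ∣ U ∣ ≡ᵇ suc ∣ T ∣) , (λ U → ∣ T ∩ U ∣ ≡ᵇ ∣ T ∣) ⟩ F ≡
        sum λ x → when (not (lookup T x)) (F (T [ x ]≔ inside))
∑-add []            F = refl
∑-add (inside ∷ T)  F = trans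
  (cong₂ _+_ (∑-add T (F ∘ (inside ∷_)))
             (∑-empty ∣_∣ (λ U → ∣ T ∩ U ∣) _ _ _ λ U _ e → ℕₚ.<⇒≢ (ℕ.s≤s (∣p∩q∣≤∣p∣ T U)) e))
  (ℤₚ.+-comm (sum λ x → when (not (lookup T x)) (F (inside ∷ T [ x ]≔ inside))) 0ℤ)
∑-add (outside ∷ T) F = cong₂ _+_ (∑-same T (F ∘ (inside ∷_))) (∑-add T (F ∘ (outside ∷_)))

∑-remove : ∀ {n} (T : Subset n) F →
           ∑⟨ (λ U → suc ∣ U ∣ ≡ᵇ ∣ T ∣) , (λ U → suc ∣ T ∩ U ∣ ≡ᵇ ∣ T ∣) ⟩ F ≡
           sum λ y → when (lookup T y) (F (T [ y ]≔ outside))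
∑-remove []            F = refl
∑-remove (inside ∷ T)  F = trans
  (cong₂ _+_ (∑-remove T (F ∘ (inside ∷_))) (∑-same T (F ∘ (outside ∷_))))
  (ℤₚ.+-comm _ (F (outside ∷ T)))
∑-remove (outside ∷ T) F = cong₂ _+_
  (∑-empty (λ U → suc (suc ∣ U ∣)) (λ U → suc ∣ T ∩ U ∣) ∣ T ∣ ∣ T ∣ (F ∘ (inside ∷_))
     (λ U s e → ℕₚ.<⇒≢ (ℕ.s≤s (ℕ.s≤s (∣p∩q∣≤∣q∣ T U))) (trans e (sym s))))
  (∑-remove T (F ∘ (outside ∷_)))

-- Compare the heads of `T` and `U`. If they agree, the exchange happens in the tails. If only `T`
-- has the head, it is the element removed and the tails differ by an addition (`∑-add`); if only
-- `U` has it, it is the element added and the tails differ by a removal (`∑-remove`).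
∑-swap : ∀ {n} (T : Subset n) F →
         ∑⟨ (λ U → ∣ U ∣ ≡ᵇ ∣ T ∣) , (λ U → suc ∣ T ∩ U ∣ ≡ᵇ ∣ T ∣) ⟩ F ≡
         sum λ y → when (lookup T y) (sum λ x → when (not (lookup T x)) (F (T [ y ]≔ outside [ x ]≔ inside)))
∑-swap []            F = refl
∑-swap {suc n} (inside ∷ T) F = begin
  _              ≡⟨ cong₂ _+_ (∑-swap T (F ∘ (inside ∷_))) (∑-add T (F ∘ (outside ∷_))) ⟩
  removed + kept ≡⟨ ℤₚ.+-comm removed kept ⟩
  kept + removed ≡⟨ cong₂ _+_ (sym (ℤₚ.+-identityˡ kept))
                     (sum-cong-≗ λ y → cong (when (lookup T y)) (sym (ℤₚ.+-identityˡ (inner y)))) ⟩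
  _              ∎
  where
  open ≡-Reasoning
  inner : Fin n → ℤ
  inner y = sum λ x → when (not (lookup T x)) (F (inside ∷ T [ y ]≔ outside [ x ]≔ inside))
  removed kept : ℤ
  removed = sum λ y → when (lookup T y) (inner y)
  kept    = sum λ x → when (not (lookup T x)) (F (outside ∷ T [ x ]≔ inside))
∑-swap (outside ∷ T) F = begin
  _ ≡⟨ cong₂ _+_ (∑-remove T (F ∘ (inside ∷_))) (∑-swap T (F ∘ (outside ∷_))) ⟩
  _ ≡⟨ sym (∑-distrib-+ (λ y → when (lookup T y) (F (inside ∷ T [ y ]≔ outside))) _) ⟩
  _ ≡⟨ sum-cong-≗ (λ y → sym (when-+ (lookup T y) _ _)) ⟩
  _ ≡⟨ sym (ℤₚ.+-identityˡ _) ⟩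
  _ ∎
  where open ≡-Reasoning

≡ᵇ-true : ∀ {m n} → m ≡ n → (m ≡ᵇ n) ≡ true
≡ᵇ-true {zero}  refl = refl
≡ᵇ-true {suc m} refl = ≡ᵇ-true {m} refl

swapSum : ∀ {n} → Subset n → (Subset n → ℤ) → ℤ
swapSum T F = sum λ y → when (lookup T y) (sum λ x → when (not (lookup T x)) (F (T [ y ]≔ outside [ x ]≔ inside)))

adjApply-swap : ∀ {n} (v : Vertex n 3 → ℤ) (F : Subset n → ℤ) → (∀ U q → v (U , q) ≡ F U) →
                ∀ S p → adjApply n 3 v (S , p) ≡ swapSum S F
adjApply-swap {n} v F v≡F S p = trans (foldSub-cong _+_ (λ U → trans (pointwise U)
    (cong (λ m → when (∣ U ∣ ≡ᵇ m) (when (suc ∣ S ∩ U ∣ ≡ᵇ m) (F U))) (sym p)))) (∑-swap S F)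
  where
  -- The summand is local to `sumV` and `adjApply`; solving for it by `refl` makes it available by
  -- projection.
  summand : ∃ λ g → adjApply n 3 v (S , p) ≡ foldSub _+_ g
  summand = _ , refl
  pointwise : ∀ U → proj₁ summand U ≡ when (∣ U ∣ ≡ᵇ 3) (when (∣ S ∩ U ∣ ≡ᵇ 2) (F U))
  pointwise U with ∣ U ∣ ℕ.≟ 3
  ... | no  s≢3 rewrite ≡ᵇ-false s≢3 = refl
  ... | yes s≡3 rewrite ≡ᵇ-true s≡3 with ∣ S ∩ U ∣ ℕ.≟ 2
  ...   | no  m≢2 rewrite ≡ᵇ-false m≢2 = refl
  ...   | yes m≡2 rewrite ≡ᵇ-true m≡2 = v≡F U s≡3

-- The extension by zero to all subsets turns every sum over vertices into a sum over Subset n.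
extend : ∀ {n} → (Vertex n 3 → ℤ) → Subset n → ℤ
extend v U with ∣ U ∣ ℕ.≟ 3
... | yes q = v (U , q)
... | no  _ = 0ℤ

extend-vertex : ∀ {n} (v : Vertex n 3 → ℤ) U q → v (U , q) ≡ extend v U
extend-vertex v U q with ∣ U ∣ ℕ.≟ 3
... | yes q′  = cong (λ r → v (U , r)) (ℕₚ.≡-irrelevant q q′)
... | no  ¬q = ⊥-elim (¬q q)

extend-zero : ∀ {n} (v : Vertex n 3 → ℤ) U → ∣ U ∣ ≢ 3 → extend v U ≡ 0ℤ
extend-zero v U ¬q with ∣ U ∣ ℕ.≟ 3
... | yes q = ⊥-elim (¬q q)
... | no  _ = refl

-- Pairs and triples as subsets

∣p[i]≔in∣ : ∀ {n} (p : Subset n) i → lookup p i ≡ outside → ∣ p [ i ]≔ inside ∣ ≡ suc ∣ p ∣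
∣p[i]≔in∣ (outside ∷ p) zero    _ = refl
∣p[i]≔in∣ (inside  ∷ p) (suc i) e = cong suc (∣p[i]≔in∣ p i e)
∣p[i]≔in∣ (outside ∷ p) (suc i) e = ∣p[i]≔in∣ p i e

∣p[i]≔in∣≤ : ∀ {n} (p : Subset n) i → ∣ p [ i ]≔ inside ∣ ℕ.≤ suc ∣ p ∣
∣p[i]≔in∣≤ (inside  ∷ p) zero    = ℕₚ.n≤1+n _
∣p[i]≔in∣≤ (outside ∷ p) zero    = ℕₚ.≤-refl
∣p[i]≔in∣≤ (inside  ∷ p) (suc i) = ℕ.s≤s (∣p[i]≔in∣≤ p i)
∣p[i]≔in∣≤ (outside ∷ p) (suc i) = ∣p[i]≔in∣≤ p i

[]≔-self : ∀ {n} (p : Subset n) i {b} → lookup p i ≡ b → p [ i ]≔ b ≡ p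
[]≔-self p i refl = []≔-lookup p i

sumOver : ∀ {n} → Subset n → (Fin n → ℤ) → ℤ
sumOver p f = sum λ y → when (lookup p y) (f y)

sumOver-insert : ∀ {n} (p : Subset n) i f → lookup p i ≡ outside →
                 sumOver (p [ i ]≔ inside) f ≡ f i + sumOver p f
sumOver-insert (outside ∷ p) zero    f _ = cong (λ z → f zero + z) (sym (ℤₚ.+-identityˡ _))
sumOver-insert (b       ∷ p) (suc i) f e =
  trans (cong (λ z → when b (f zero) + z) (sumOver-insert p i (f ∘ suc) e))
        (swap (when b (f zero)) (f (suc i)) (sumOver p (f ∘ suc)))
  where
  swap : ∀ x y z → x + (y + z) ≡ y + (x + z)
  swap = solve-∀

∅ : ∀ {n} → Subset n
∅ = replicate _ outside

sumOver-∅ : ∀ {n} (f : Fin n → ℤ) → sumOver ∅ f ≡ 0ℤ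
sumOver-∅ f = sum-zero _ λ i → cong (λ b → when b (f i)) (lookup-replicate i outside)

pair : ∀ {n} → Fin n → Fin n → Subset n
pair i j = ∅ [ i ]≔ inside [ j ]≔ inside

triple : ∀ {n} → Fin n → Fin n → Fin n → Subset n
triple i j k = pair i j [ k ]≔ inside

Distinct : ∀ {n} → Fin n → Fin n → Fin n → Set
Distinct i j k = i ≢ j × i ≢ k × j ≢ k

[]≔-swap : ∀ {n} (p : Subset n) i j →
           p [ i ]≔ inside [ j ]≔ inside ≡ p [ j ]≔ inside [ i ]≔ inside
[]≔-swap p i j with i Fₚ.≟ j
... | yes refl = refl
... | no  i≢j  = []≔-commutes p i j i≢j

pair-sym : ∀ {n} (i j : Fin n) → pair i j ≡ pair j i
pair-sym = []≔-swap ∅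

triple-swap₂₃ : ∀ {n} (i j k : Fin n) → triple i j k ≡ triple i k j
triple-swap₂₃ i j k = []≔-swap (∅ [ i ]≔ inside) j k

triple-swap₁₂ : ∀ {n} (i j k : Fin n) → triple i j k ≡ triple j i k
triple-swap₁₂ i j k = cong (_[ k ]≔ inside) (pair-sym i j)

lookup-singleton : ∀ {n} {i j : Fin n} → i ≢ j → lookup (∅ [ i ]≔ inside) j ≡ outside
lookup-singleton {i = i} {j} i≢j =
  trans (lookup∘update′ (i≢j ∘ sym) ∅ inside) (lookup-replicate j outside)

lookup-pair : ∀ {n} {i j k : Fin n} → i ≢ k → j ≢ k → lookup (pair i j) k ≡ outside
lookup-pair {i = i} i≢k j≢k = trans (lookup∘update′ (j≢k ∘ sym) (∅ [ i ]≔ inside) inside) (lookup-singleton i≢k)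

∣singleton∣ : ∀ {n} (i : Fin n) → ∣ ∅ [ i ]≔ inside ∣ ≡ 1
∣singleton∣ {n} i = trans (∣p[i]≔in∣ ∅ i (lookup-replicate i outside)) (cong suc (∣⊥∣≡0 n))

∣triple∣ : ∀ {n} {i j k : Fin n} → Distinct i j k → ∣ triple i j k ∣ ≡ 3
∣triple∣ {i = i} {j} {k} (i≢j , i≢k , j≢k) =
  trans (∣p[i]≔in∣ (pair i j) k (lookup-pair i≢k j≢k))
  (cong suc (trans (∣p[i]≔in∣ (∅ [ i ]≔ inside) j (lookup-singleton i≢j)) (cong suc (∣singleton∣ i))))

∣pair∣≢3 : ∀ {n} (i j : Fin n) → ∣ pair i j ∣ ≢ 3
∣pair∣≢3 i j = ℕₚ.<⇒≢ (ℕ.s≤s (ℕₚ.≤-trans (∣p[i]≔in∣≤ (∅ [ i ]≔ inside) j) (ℕ.s≤s (ℕₚ.≤-reflexive (∣singleton∣ i)))))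

sumOver-triple : ∀ {n} {i j k : Fin n} f → Distinct i j k → sumOver (triple i j k) f ≡ f k + (f j + f i)
sumOver-triple {i = i} {j} {k} f (i≢j , i≢k , j≢k) = begin
  sumOver (triple i j k) f                          ≡⟨ sumOver-insert (pair i j) k f (lookup-pair i≢k j≢k) ⟩
  f k + sumOver (pair i j) f                        ≡⟨ cong (λ z → f k + z) (sumOver-insert (∅ [ i ]≔ inside) j f (lookup-singleton i≢j)) ⟩
  f k + (f j + sumOver (∅ [ i ]≔ inside) f)         ≡⟨ cong (λ z → f k + (f j + z)) (sumOver-insert ∅ i f (lookup-replicate i outside)) ⟩
  f k + (f j + (f i + sumOver ∅ f))                 ≡⟨ cong (λ z → f k + (f j + (f i + z))) (sumOver-∅ f) ⟩
  f k + (f j + (f i + 0ℤ))                          ≡⟨ cong (λ z → f k + (f j + z)) (ℤₚ.+-identityʳ (f i)) ⟩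
  f k + (f j + f i)                                 ∎
  where open ≡-Reasoning

δ : ∀ {n} → Fin n → Fin n → ℤ
δ zero    zero    = 1ℤ
δ zero    (suc j) = 0ℤ
δ (suc i) zero    = 0ℤ
δ (suc i) (suc j) = δ i j

δ-refl : ∀ {n} (i : Fin n) → δ i i ≡ 1ℤ
δ-refl zero    = refl
δ-refl (suc i) = δ-refl i

δ-≢ : ∀ {n} {i j : Fin n} → i ≢ j → δ i j ≡ 0ℤ
δ-≢ {i = zero}  {zero}  i≢j = ⊥-elim (i≢j refl)
δ-≢ {i = zero}  {suc j} i≢j = refl
δ-≢ {i = suc i} {zero}  i≢j = refl
δ-≢ {i = suc i} {suc j} i≢j = δ-≢ (i≢j ∘ cong suc)

sum-δ : ∀ {n} (i : Fin n) (f : Fin n → ℤ) → (sum λ j → δ i j * f j) ≡ f i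
sum-δ zero    f = trans (cong₂ _+_ (ℤₚ.*-identityˡ (f zero)) (sum-zero _ λ j → ℤₚ.*-zeroˡ (f (suc j)))) (ℤₚ.+-identityʳ (f zero))
sum-δ (suc i) f = trans (cong₂ _+_ (ℤₚ.*-zeroˡ (f zero)) (sum-δ i (f ∘ suc))) (ℤₚ.+-identityˡ (f (suc i)))

-- Letting `x` run over all points adds only the terms with `x` in `p`, which equal `F p` and
-- vanish, and the term `x ≡ k`, which is `F T`. For a pair `p` and the extension by zero of a
-- vector, `F p ≡ 0ℤ` holds.
replace-sum : ∀ {n} (p : Subset n) k (F : Subset n → ℤ) → lookup p k ≡ outside → F p ≡ 0ℤ →
  let T = p [ k ]≔ inside in
  (sum λ x → when (not (lookup T x)) (F (T [ k ]≔ outside [ x ]≔ inside))) ≡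
  (sum λ x → F (p [ x ]≔ inside)) - F T
replace-sum {n} p k F k∉p Fp≡0 = begin
  sum others                       ≡⟨ cancel (sum others) (F T) ⟩
  (sum others + F T) - F T         ≡⟨ cong (λ z → (sum others + z) - F T) (sym (sum-δ k (λ x → F (p [ x ]≔ inside)))) ⟩
  (sum others + sum (λ x → δ k x * F (p [ x ]≔ inside))) - F T
                                   ≡⟨ cong (_- F T) (sym (∑-distrib-+ others _)) ⟩
  sum (λ x → others x + δ k x * F (p [ x ]≔ inside)) - F T
                                   ≡⟨ cong (_- F T) (sum-cong-≗ pointwise) ⟩
  _                                ∎
  where
  open ≡-Reasoning
  T = p [ k ]≔ inside
  others : Fin n → ℤ
  others x = when (not (lookup T x)) (F (T [ k ]≔ outside [ x ]≔ inside))
  cancel : ∀ x y → x ≡ (x + y) - y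
  cancel = solve-∀
  T-k : T [ k ]≔ outside ≡ p
  T-k = trans ([]≔-idempotent p k) ([]≔-self p k k∉p)
  one : ∀ y → 0ℤ + 1ℤ * y ≡ y
  one = solve-∀
  none : ∀ x y → x + 0ℤ * y ≡ x
  none = solve-∀
  pointwise : ∀ x → others x + δ k x * F (p [ x ]≔ inside) ≡ F (p [ x ]≔ inside)
  pointwise x rewrite T-k with k Fₚ.≟ x
  ... | yes refl rewrite lookup∘update k p inside | δ-refl k = one _
  ... | no  k≢x  rewrite lookup∘update′ (k≢x ∘ sym) p inside | δ-≢ k≢x with lookup p x in e
  ...   | true  rewrite []≔-self p x e | Fp≡0 = refl
  ...   | false = none (F (p [ x ]≔ inside)) (F (p [ x ]≔ inside))

-- Coordinates of a θ₁-eigenvector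

fresh : ∀ {n} (E : List (Fin n)) → length E ℕ.< n → ∃ λ x → All (x ≢_) E
fresh {n} E short with Fₚ.any? (λ x → ¬? (DecMem._∈?_ Fₚ._≟_ x E))
... | yes (x , x∉E) = x , Allₚ.¬Any⇒All¬ E x∉E
... | no  all∈E = ⊥-elim (repeats (Fₚ.pigeonhole short (index ∘ covered)))
  where
  covered : ∀ x → x ∈ E
  covered x = decidable-stable (DecMem._∈?_ Fₚ._≟_ x E) λ x∉E → all∈E (x , x∉E)
  repeats : ¬ (∃₂ λ i j → i F.< j × index (covered i) ≡ index (covered j))
  repeats (i , j , i<j , same) =
    Fₚ.<⇒≢ i<j (trans (Anyₚ.lookup-index (covered i))
               (trans (cong (L.lookup E) same) (sym (Anyₚ.lookup-index (covered j)))))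

sum-const : ∀ n c → sum {n} (λ _ → c) ≡ + n * c
sum-const zero    c = sym (ℤₚ.*-zeroˡ c)
sum-const (suc n) c = trans (cong (λ z → c + z) (sum-const n c)) (sym (ℤₚ.suc-* (+ n) c))

sum-*ˡ : ∀ {n} c (f : Fin n → ℤ) → (sum λ i → c * f i) ≡ c * sum f
sum-*ˡ c f = sym (*-distribˡ-sum c f)

-- `harmonic` is A v = (2n - 9) v on the triple ijk: exchanging one element k sums to Σₓ w i j x - w i j k.
record Eigentriple {n} (w : Fin n → Fin n → Fin n → ℤ) : Set where
  field
    swap₁₂   : ∀ i j k → w i j k ≡ w j i k
    swap₂₃   : ∀ i j k → w i j k ≡ w i k j
    repeat   : ∀ i k → w i i k ≡ 0ℤ
    harmonic : ∀ {i j k} → Distinct i j k →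
               (+ 2 * + n - + 6) * w i j k ≡ sum (w i j) + sum (w i k) + sum (w j k)

  pairSum : Fin n → Fin n → ℤ
  pairSum i j = sum (w i j)

  pointSum : Fin n → ℤ
  pointSum i = sum (pairSum i)

  pairSum-sym : ∀ i j → pairSum i j ≡ pairSum j i
  pairSum-sym i j = sum-cong-≗ (swap₁₂ i j)

  pairSum-diag : ∀ i → pairSum i i ≡ 0ℤ
  pairSum-diag i = sum-zero _ (repeat i)

  open ≡-Reasoning

  -- When `k` is `i` or `j`, the entry on the left is 0 while the right side is twice `pairSum i j`.
  -- The `δ` terms supply the difference, so that the identity can be summed over all `k`;
  -- `pairSum-eq′` treats its diagonal in the same way.
  harmonic′ : ∀ {i j} → i ≢ j → ∀ k →
    (+ 2 * + n - + 6) * w i j k + (δ i k * (+ 2 * pairSum i j) + δ j k * (+ 2 * pairSum i j)) ≡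
    pairSum i j + pairSum i k + pairSum j k
  harmonic′ {i} {j} i≢j k with i Fₚ.≟ k | j Fₚ.≟ k
  ... | yes refl | yes refl = ⊥-elim (i≢j refl)
  ... | yes refl | no j≢k rewrite δ-refl i | δ-≢ j≢k | trans (swap₂₃ i j i) (repeat i j)
                                | pairSum-diag i | pairSum-sym j i = eq (+ n) (pairSum i j)
    where
    eq : ∀ n p → (+ 2 * n - + 6) * 0ℤ + (1ℤ * (+ 2 * p) + 0ℤ * (+ 2 * p)) ≡ p + 0ℤ + p
    eq = solve-∀
  ... | no i≢k | yes refl rewrite δ-refl j | δ-≢ i≢k | trans (swap₁₂ i j j) (trans (swap₂₃ j i j) (repeat j i))
                                | pairSum-diag j = eq (+ n) (pairSum i j)
    where
    eq : ∀ n p → (+ 2 * n - + 6) * 0ℤ + (0ℤ * (+ 2 * p) + 1ℤ * (+ 2 * p)) ≡ p + p + 0ℤ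
    eq = solve-∀
  ... | no i≢k | no j≢k rewrite δ-≢ i≢k | δ-≢ j≢k =
    trans (eq ((+ 2 * + n - + 6) * w i j k) (pairSum i j)) (harmonic (i≢j , i≢k , j≢k))
    where
    eq : ∀ x p → x + (0ℤ * (+ 2 * p) + 0ℤ * (+ 2 * p)) ≡ x
    eq = solve-∀

  pairSum-eq : ∀ {i j} → i ≢ j → (+ n - + 2) * pairSum i j ≡ pointSum i + pointSum j
  pairSum-eq {i} {j} i≢j = begin
    (N - + 2) * p                                            ≡⟨ rearrange N p ⟩
    (c * p + (+ 2 * p + + 2 * p)) - N * p                    ≡⟨ cong (_- N * p) (sym summed) ⟩
    sum (λ k → p + pairSum i k + pairSum j k) - N * p        ≡⟨ cong (_- N * p) split ⟩
    (N * p + pointSum i + pointSum j) - N * p                ≡⟨ cancel (N * p) (pointSum i) (pointSum j) ⟩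
    pointSum i + pointSum j                                  ∎
    where
    N = + n
    p = pairSum i j
    c = + 2 * N - + 6
    rearrange : ∀ N p → (N - + 2) * p ≡ ((+ 2 * N - + 6) * p + (+ 2 * p + + 2 * p)) - N * p
    rearrange = solve-∀
    cancel : ∀ a b c → (a + b + c) - a ≡ b + c
    cancel = solve-∀
    summed : (sum λ k → p + pairSum i k + pairSum j k) ≡ c * p + (+ 2 * p + + 2 * p)
    summed = begin
      (sum λ k → p + pairSum i k + pairSum j k) ≡⟨ sum-cong-≗ (λ k → sym (harmonic′ i≢j k)) ⟩
      (sum λ k → c * w i j k + (δ i k * (+ 2 * p) + δ j k * (+ 2 * p)))
        ≡⟨ ∑-distrib-+ (λ k → c * w i j k) _ ⟩
      (sum λ k → c * w i j k) + (sum λ k → δ i k * (+ 2 * p) + δ j k * (+ 2 * p))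
        ≡⟨ cong₂ _+_ (sum-*ˡ c (w i j)) (∑-distrib-+ (λ k → δ i k * (+ 2 * p)) _) ⟩
      c * p + ((sum λ k → δ i k * (+ 2 * p)) + (sum λ k → δ j k * (+ 2 * p)))
        ≡⟨ cong (λ z → c * p + z) (cong₂ _+_ (sum-δ i (λ _ → + 2 * p)) (sum-δ j (λ _ → + 2 * p))) ⟩
      c * p + (+ 2 * p + + 2 * p) ∎
    split : (sum λ k → p + pairSum i k + pairSum j k) ≡ N * p + pointSum i + pointSum j
    split = trans (∑-distrib-+ (λ k → p + pairSum i k) (pairSum j))
      (cong (λ z → z + pointSum j) (trans (∑-distrib-+ (λ _ → p) (pairSum i)) (cong (λ z → z + pointSum i) (sum-const n p))))

  pairSum-eq′ : ∀ i j → (+ n - + 2) * pairSum i j + δ i j * (+ 2 * pointSum i) ≡ pointSum i + pointSum j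
  pairSum-eq′ i j with i Fₚ.≟ j
  ... | yes refl rewrite δ-refl i | pairSum-diag i = eq (+ n) (pointSum i)
    where
    eq : ∀ n p → (n - + 2) * 0ℤ + 1ℤ * (+ 2 * p) ≡ p + p
    eq = solve-∀
  ... | no  i≢j rewrite δ-≢ i≢j = trans (eq _ (pointSum i)) (pairSum-eq i≢j)
    where
    eq : ∀ x p → x + 0ℤ * (+ 2 * p) ≡ x
    eq = solve-∀

  -- Summed over `j`, both sides of `pairSum-eq′ i j` contain `pointSum i` with coefficient `n`, and
  -- only `sum pointSum` is left over.
  sum-pointSum : Fin n → sum pointSum ≡ 0ℤ
  sum-pointSum i = begin
    sum pointSum                                            ≡⟨ insert (N * r) (sum pointSum) ⟩
    (N * r + sum pointSum) - N * r                          ≡⟨ cong (λ z → z - N * r) (sym split) ⟩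
    (sum λ j → r + pointSum j) - N * r                      ≡⟨ cong (λ z → z - N * r) summed ⟩
    ((N - + 2) * r + + 2 * r) - N * r                       ≡⟨ vanish N r ⟩
    0ℤ                                                      ∎
    where
    N = + n
    r = pointSum i
    insert : ∀ a s → s ≡ (a + s) - a
    insert = solve-∀
    vanish : ∀ N r → ((N - + 2) * r + + 2 * r) - N * r ≡ 0ℤ
    vanish = solve-∀
    split : (sum λ j → r + pointSum j) ≡ N * r + sum pointSum
    split = trans (∑-distrib-+ (λ _ → r) pointSum) (cong (λ z → z + sum pointSum) (sum-const n r))
    summed : (sum λ j → r + pointSum j) ≡ (N - + 2) * r + + 2 * r
    summed = begin
      (sum λ j → r + pointSum j)                                          ≡⟨ sum-cong-≗ (λ j → sym (pairSum-eq′ i j)) ⟩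
      (sum λ j → (N - + 2) * pairSum i j + δ i j * (+ 2 * r))             ≡⟨ ∑-distrib-+ (λ j → (N - + 2) * pairSum i j) _ ⟩
      (sum λ j → (N - + 2) * pairSum i j) + (sum λ j → δ i j * (+ 2 * r)) ≡⟨ cong₂ _+_ (sum-*ˡ (N - + 2) (pairSum i)) (sum-δ i (λ _ → + 2 * r)) ⟩
      (N - + 2) * r + + 2 * r                                             ∎

  -- The coordinate aᵢ is `pointSum i` divided by `scale`. The division is postponed, so everything
  -- stays in the integers.
  scale : ℤ
  scale = (+ n - + 2) * (+ n - + 3)

  scale-w : ∀ {i j k} → Distinct i j k → scale * w i j k ≡ pointSum i + pointSum j + pointSum k
  scale-w {i} {j} {k} d@(i≢j , i≢k , j≢k) = ℤₚ.*-cancelˡ-≡ (+ 2) _ _ (begin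
    + 2 * (scale * w i j k)                                   ≡⟨ rearrange (+ n) (w i j k) ⟩
    (N - + 2) * ((+ 2 * N - + 6) * w i j k)                   ≡⟨ cong (λ z → (N - + 2) * z) (harmonic d) ⟩
    (N - + 2) * (pairSum i j + pairSum i k + pairSum j k)     ≡⟨ distrib (N - + 2) (pairSum i j) (pairSum i k) (pairSum j k) ⟩
    (N - + 2) * pairSum i j + (N - + 2) * pairSum i k + (N - + 2) * pairSum j k
      ≡⟨ cong₂ _+_ (cong₂ _+_ (pairSum-eq i≢j) (pairSum-eq i≢k)) (pairSum-eq j≢k) ⟩
    (pointSum i + pointSum j) + (pointSum i + pointSum k) + (pointSum j + pointSum k)
      ≡⟨ collect (pointSum i) (pointSum j) (pointSum k) ⟩
    + 2 * (pointSum i + pointSum j + pointSum k) ∎)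
    where
    N = + n
    rearrange : ∀ N w → + 2 * ((N - + 2) * (N - + 3) * w) ≡ (N - + 2) * ((+ 2 * N - + 6) * w)
    rearrange = solve-∀
    distrib : ∀ c x y z → c * (x + y + z) ≡ c * x + c * y + c * z
    distrib = solve-∀
    collect : ∀ x y z → (x + y) + (x + z) + (y + z) ≡ + 2 * (x + y + z)
    collect = solve-∀

-- Three times the coordinates a of an eigenvector v(T) = Σ_{i ∈ T} aᵢ: the aᵢ themselves need only be thirds of integers.
record Weights {n} (w : Fin n → Fin n → Fin n → ℤ) : Set where
  field
    b        : Fin n → ℤ
    b-sum    : sum b ≡ 0ℤ
    b-triple : ∀ {i j k} → Distinct i j k → + 3 * w i j k ≡ b i + b j + b k
    b-mod3   : ∀ i j → ∃ λ d → b i ≡ b j + + 3 * d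

-- With `n` written as `4 ℕ.+ m`, the two factors compute to `+ (2 ℕ.+ m)` and `+ (1 ℕ.+ m)`,
-- visibly nonzero.
cancel-scale : ∀ m {x y} → let n = 4 ℕ.+ m; s = (+ n - + 2) * (+ n - + 3) in s * x ≡ s * y → x ≡ y
cancel-scale m {x} {y} eq = ℤₚ.*-cancelˡ-≡ (+ (1 ℕ.+ m)) x y (ℤₚ.*-cancelˡ-≡ (+ (2 ℕ.+ m)) _ _
  (trans (sym (ℤₚ.*-assoc (+ (2 ℕ.+ m)) (+ (1 ℕ.+ m)) x)) (trans eq (ℤₚ.*-assoc (+ (2 ℕ.+ m)) (+ (1 ℕ.+ m)) y))))

weights : ∀ {n} {w : Fin n → Fin n → Fin n → ℤ} → 4 ℕ.< n → Eigentriple w → Weights w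
weights {suc (suc (suc (suc m)))} {w} 4<n ev = record
  { b        = b
  ; b-sum    = cancel-scale m (begin
      scale * sum b                ≡⟨ *-distribˡ-sum scale b ⟩
      (sum λ i → scale * b i)      ≡⟨ sum-cong-≗ scale-b ⟩
      (sum λ i → + 3 * pointSum i) ≡⟨ sum-*ˡ (+ 3) pointSum ⟩
      + 3 * sum pointSum           ≡⟨ cong (λ z → + 3 * z) (sum-pointSum zero) ⟩
      0ℤ                           ≡⟨ sym (ℤₚ.*-zeroʳ scale) ⟩
      scale * 0ℤ                   ∎)
  ; b-triple = λ {i} {j} {k} d → cancel-scale m (begin
      scale * (+ 3 * w i j k)                              ≡⟨ comm scale (w i j k) ⟩
      + 3 * (scale * w i j k)                              ≡⟨ cong (λ z → + 3 * z) (scale-w d) ⟩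
      + 3 * (pointSum i + pointSum j + pointSum k)         ≡⟨ distrib (+ 3) (pointSum i) (pointSum j) (pointSum k) ⟩
      + 3 * pointSum i + + 3 * pointSum j + + 3 * pointSum k
        ≡⟨ sym (cong₂ _+_ (cong₂ _+_ (scale-b i) (scale-b j)) (scale-b k)) ⟩
      scale * b i + scale * b j + scale * b k              ≡⟨ sym (distrib scale (b i) (b j) (b k)) ⟩
      scale * (b i + b j + b k)                            ∎)
  ; b-mod3   = mod3
  }
  where
  open Eigentriple ev
  open ≡-Reasoning
  comm : ∀ s x → s * (+ 3 * x) ≡ + 3 * (s * x)
  comm = solve-∀
  distrib : ∀ c x y z → c * (x + y + z) ≡ c * x + c * y + c * z
  distrib = solve-∀

  -- Two triples sharing `p` and `q` have entries differing by aᵢ - aⱼ, so differences of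
  -- coordinates are integers; this gives the congruence modulo 3.
  exchange : ∀ {i j p q} → Distinct i p q → Distinct j p q → scale * (w i p q - w j p q) ≡ pointSum i - pointSum j
  exchange {i} {j} {p} {q} d e = begin
    scale * (w i p q - w j p q)         ≡⟨ dist scale (w i p q) (w j p q) ⟩
    scale * w i p q - scale * w j p q   ≡⟨ cong₂ _-_ (scale-w d) (scale-w e) ⟩
    (pointSum i + pointSum p + pointSum q) - (pointSum j + pointSum p + pointSum q)
                                        ≡⟨ cancel (pointSum i) (pointSum j) (pointSum p) (pointSum q) ⟩
    pointSum i - pointSum j             ∎
    where
    dist : ∀ s x y → s * (x - y) ≡ s * x - s * y
    dist = solve-∀
    cancel : ∀ i j p q → (i + p + q) - (j + p + q) ≡ i - j
    cancel = solve-∀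

  -- 3aᵢ = (aᵢ + aⱼ + aₖ) + (aᵢ - aⱼ) + (aᵢ - aₖ): one entry and two differences of entries. The
  -- differences are taken along two further points `p` and `q`, so five points are required.
  divide : ∀ i → ∃ λ x → scale * x ≡ + 3 * pointSum i
  divide i with fresh (i ∷ []) (ℕₚ.≤-trans (ℕ.s≤s (ℕ.s≤s ℕ.z≤n)) 4<n)
  ... | j , j≢i ∷ [] with fresh (i ∷ j ∷ []) (ℕₚ.≤-trans (ℕ.s≤s (ℕ.s≤s (ℕ.s≤s ℕ.z≤n))) 4<n)
  ... | k , k≢i ∷ k≢j ∷ [] with fresh (i ∷ j ∷ k ∷ []) (ℕₚ.≤-trans (ℕ.s≤s (ℕ.s≤s (ℕ.s≤s (ℕ.s≤s ℕ.z≤n)))) 4<n)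
  ... | p , p≢i ∷ p≢j ∷ p≢k ∷ [] with fresh (i ∷ j ∷ k ∷ p ∷ []) 4<n
  ... | q , q≢i ∷ q≢j ∷ q≢k ∷ q≢p ∷ [] = w i j k + ((w i p q - w j p q) + (w i p q - w k p q)) , (begin
    scale * (w i j k + ((w i p q - w j p q) + (w i p q - w k p q)))
      ≡⟨ dist scale (w i j k) (w i p q - w j p q) (w i p q - w k p q) ⟩
    scale * w i j k + (scale * (w i p q - w j p q) + scale * (w i p q - w k p q))
      ≡⟨ cong₂ _+_ (scale-w (j≢i ∘ sym , k≢i ∘ sym , k≢j ∘ sym))
                   (cong₂ _+_ (exchange di (p≢j ∘ sym , q≢j ∘ sym , q≢p ∘ sym))
                              (exchange di (p≢k ∘ sym , q≢k ∘ sym , q≢p ∘ sym))) ⟩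
    (pointSum i + pointSum j + pointSum k) + ((pointSum i - pointSum j) + (pointSum i - pointSum k))
      ≡⟨ collect (pointSum i) (pointSum j) (pointSum k) ⟩
    + 3 * pointSum i ∎)
    where
    di : Distinct i p q
    di = p≢i ∘ sym , q≢i ∘ sym , q≢p ∘ sym
    dist : ∀ s x y z → s * (x + (y + z)) ≡ s * x + (s * y + s * z)
    dist = solve-∀
    collect : ∀ i j k → (i + j + k) + ((i - j) + (i - k)) ≡ + 3 * i
    collect = solve-∀

  b : Fin _ → ℤ
  b i = proj₁ (divide i)

  scale-b : ∀ i → scale * b i ≡ + 3 * pointSum i
  scale-b i = proj₂ (divide i)

  mod3 : ∀ i j → ∃ λ d → b i ≡ b j + + 3 * d
  mod3 i j with fresh (i ∷ j ∷ []) (ℕₚ.≤-trans (ℕ.s≤s (ℕ.s≤s (ℕ.s≤s ℕ.z≤n))) 4<n)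
  ... | p , p≢i ∷ p≢j ∷ [] with fresh (i ∷ j ∷ p ∷ []) (ℕₚ.≤-trans (ℕ.s≤s (ℕ.s≤s (ℕ.s≤s (ℕ.s≤s ℕ.z≤n)))) 4<n)
  ... | q , q≢i ∷ q≢j ∷ q≢p ∷ [] = w i p q - w j p q , cancel-scale m (begin
    scale * b i                                               ≡⟨ scale-b i ⟩
    + 3 * pointSum i                                          ≡⟨ split (pointSum i) (pointSum j) ⟩
    + 3 * pointSum j + + 3 * (pointSum i - pointSum j)        ≡⟨ cong₂ (λ x y → x + + 3 * y) (sym (scale-b j))
        (sym (exchange (p≢i ∘ sym , q≢i ∘ sym , q≢p ∘ sym) (p≢j ∘ sym , q≢j ∘ sym , q≢p ∘ sym))) ⟩
    scale * b j + + 3 * (scale * (w i p q - w j p q))         ≡⟨ factor scale (b j) (w i p q - w j p q) ⟩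
    scale * (b j + + 3 * (w i p q - w j p q))                 ∎)
    where
    split : ∀ i j → + 3 * i ≡ + 3 * j + + 3 * (i - j)
    split = solve-∀
    factor : ∀ s x y → s * x + + 3 * (s * y) ≡ s * (x + + 3 * y)
    factor = solve-∀

weights {0} ()
weights {1} (ℕ.s≤s ())
weights {2} (ℕ.s≤s (ℕ.s≤s ()))
weights {3} (ℕ.s≤s (ℕ.s≤s (ℕ.s≤s ())))

theta1-value : ∀ {n} → 4 ℕ.≤ n → theta1 n 3 ≡ + 2 * + n - + 9
theta1-value {suc (suc (suc (suc m)))} _ = trans (cong (_- + 1) (ℤₚ.pos-* 2 m)) (eq (+ m))
  where
  eq : ∀ m → + 2 * m - + 1 ≡ + 2 * (+ 4 + m) - + 9
  eq = solve-∀
theta1-value {0} ()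
theta1-value {1} (ℕ.s≤s ())
theta1-value {2} (ℕ.s≤s (ℕ.s≤s ()))
theta1-value {3} (ℕ.s≤s (ℕ.s≤s (ℕ.s≤s ())))

onTriples : ∀ {n} → (Vertex n 3 → ℤ) → Fin n → Fin n → Fin n → ℤ
onTriples v i j k = extend v (triple i j k)

eigentriple : ∀ {n} (v : Vertex n 3 → ℤ) → 4 ℕ.≤ n → (∀ x → adjApply n 3 v x ≡ theta1 n 3 * v x) →
              Eigentriple (onTriples v)
eigentriple {n} v 4≤n eigen = record
  { swap₁₂   = λ i j k → cong (extend v) (triple-swap₁₂ i j k)
  ; swap₂₃   = λ i j k → cong (extend v) (triple-swap₂₃ i j k)
  ; repeat   = λ i k → extend-zero v (triple i i k)
      λ e → ∣pair∣≢3 i k (trans (cong (λ s → ∣ s [ k ]≔ inside ∣) (sym ([]≔-idempotent ∅ i))) e)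
  ; harmonic = harmonic
  }
  where
  open ≡-Reasoning
  w = onTriples v
  inner : Subset n → Fin n → ℤ
  inner S y = sum λ x → when (not (lookup S x)) (extend v (S [ y ]≔ outside [ x ]≔ inside))
  -- `S` is kept apart from `triple i j k` so that one subset can be read with each of its three
  -- elements in the last place.
  inner-last : ∀ {i j k} S → S ≡ triple i j k → i ≢ k → j ≢ k → inner S k ≡ sum (w i j) - extend v S
  inner-last {i} {j} {k} _ refl i≢k j≢k =
    replace-sum (pair i j) k (extend v) (lookup-pair i≢k j≢k) (extend-zero v (pair i j) (∣pair∣≢3 i j))
  harmonic : ∀ {i j k} → Distinct i j k →
             (+ 2 * + n - + 6) * w i j k ≡ sum (w i j) + sum (w i k) + sum (w j k)
  harmonic {i} {j} {k} d@(i≢j , i≢k , j≢k) = begin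
    (+ 2 * + n - + 6) * w i j k                ≡⟨ split (+ n) (w i j k) ⟩
    (+ 2 * + n - + 9) * w i j k + + 3 * w i j k ≡⟨ cong (λ θ → θ * w i j k + + 3 * w i j k) (sym (theta1-value 4≤n)) ⟩
    theta1 n 3 * w i j k + + 3 * w i j k       ≡⟨ cong (λ z → z + + 3 * w i j k) applied ⟩
    ((sum (w i j) - w i j k) + ((sum (w i k) - w i j k) + (sum (w j k) - w i j k))) + + 3 * w i j k
                                               ≡⟨ collect (sum (w i j)) (sum (w i k)) (sum (w j k)) (w i j k) ⟩
    sum (w i j) + sum (w i k) + sum (w j k)    ∎
    where
    S = triple i j k
    split : ∀ n w → (+ 2 * n - + 6) * w ≡ (+ 2 * n - + 9) * w + + 3 * w
    split = solve-∀
    collect : ∀ x y z w → ((x - w) + ((y - w) + (z - w))) + + 3 * w ≡ x + y + z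
    collect = solve-∀
    applied : theta1 n 3 * w i j k ≡ (sum (w i j) - w i j k) + ((sum (w i k) - w i j k) + (sum (w j k) - w i j k))
    applied = begin
      theta1 n 3 * w i j k                    ≡⟨ cong (λ z → theta1 n 3 * z) (sym (extend-vertex v S (∣triple∣ d))) ⟩
      theta1 n 3 * v (S , ∣triple∣ d)         ≡⟨ sym (eigen (S , ∣triple∣ d)) ⟩
      adjApply n 3 v (S , ∣triple∣ d)         ≡⟨ adjApply-swap v (extend v) (extend-vertex v) S (∣triple∣ d) ⟩
      sumOver S (inner S)                     ≡⟨ sumOver-triple (inner S) d ⟩
      inner S k + (inner S j + inner S i)     ≡⟨ cong₂ _+_ (inner-last S refl i≢k j≢k) (cong₂ _+_
        (inner-last S (triple-swap₂₃ i j k) i≢j (j≢k ∘ sym))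
        (inner-last S (trans (triple-swap₁₂ i j k) (triple-swap₂₃ j i k)) (i≢j ∘ sym) (i≢k ∘ sym))) ⟩
      _ ∎

-- Heavy values

sum-mono : ∀ {n} {f g : Fin n → ℤ} → (∀ i → f i ≤ g i) → sum f ≤ sum g
sum-mono {zero}  f≤g = ℤₚ.≤-refl
sum-mono {suc n} f≤g = ℤₚ.+-mono-≤ (f≤g zero) (sum-mono (f≤g ∘ suc))

-- The range of three times a nonzero entry of absolute value at most 5; divisibility by 3 is
-- recorded separately in `Congruent`.
Admissible : ℤ → Set
Admissible z = z ≢ 0ℤ × -[1+ 14 ] ≤ z × z ≤ + 15

record Spread {n} (b : Fin n → ℤ) : Set where
  field
    total      : sum b ≡ 0ℤ
    admissible : ∀ {i j k} → Distinct i j k → Admissible (b i + b j + b k)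

Heavy : ∀ {n} → (Fin n → ℤ) → ℤ → Set
Heavy b t = ∃ λ i → ∃ λ j → ∃ λ k → Distinct i j k × b i ≡ t × b j ≡ t × b k ≡ t

sum-neg : ∀ {n} (b : Fin n → ℤ) → sum (λ i → - b i) ≡ - sum b
sum-neg {zero}  b = refl
sum-neg {suc n} b = trans (cong (λ z → - b zero + z) (sum-neg (b ∘ suc))) (sym (ℤₚ.neg-distrib-+ (b zero) _))

spread-neg : ∀ {n} {b : Fin n → ℤ} → Spread b → Spread (λ i → - b i)
spread-neg {b = b} sp = record
  { total      = trans (sum-neg b) (cong (λ z → - z) total)
  ; admissible = λ {i} {j} {k} d → subst Admissible (neg (b i) (b j) (b k)) (flip (admissible d))
  }
  where
  open Spread sp
  neg : ∀ x y z → - (x + y + z) ≡ - x + - y + - z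
  neg = solve-∀
  flip : ∀ {z} → Admissible z → Admissible (- z)
  flip {z} (z≢0 , l , u) =
    (λ e → z≢0 (trans (sym (ℤₚ.neg-involutive z)) (cong (λ y → - y) e))) , ℤₚ.neg-mono-≤ u , ℤₚ.neg-mono-≤ l

heavy-neg : ∀ {n} {b : Fin n → ℤ} {t} → Heavy (λ i → - b i) t → Heavy b (- t)
heavy-neg {b = b} (i , j , k , d , p , q , r) = i , j , k , d , flip p , flip q , flip r
  where
  flip : ∀ {i t} → - b i ≡ t → b i ≡ - t
  flip {i} e = trans (sym (ℤₚ.neg-involutive (b i))) (cong (λ y → - y) e)

-- If fewer than two points satisfy `P`, arbitrary other points fill the places of `i` and `j`, so
-- the counting below always deals with two distinct points.
three-or-two : ∀ {n} → 2 ℕ.< n → {P : Fin n → Set} → (∀ x → Dec (P x)) →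
  (∃ λ i → ∃ λ j → ∃ λ k → Distinct i j k × P i × P j × P k) ⊎
  (∃ λ i → ∃ λ j → i ≢ j × (∀ x → P x → x ≡ i ⊎ x ≡ j))
three-or-two {n} 2<n {P} P? with Fₚ.any? P?
... | no none with fresh [] (ℕₚ.≤-trans (ℕ.s≤s ℕ.z≤n) 2<n)
...   | i , [] with fresh (i ∷ []) (ℕₚ.≤-trans (ℕ.s≤s (ℕ.s≤s ℕ.z≤n)) 2<n)
...   | j , j≢i ∷ [] = inj₂ (i , j , j≢i ∘ sym , λ x px → ⊥-elim (none (x , px)))
three-or-two {n} 2<n {P} P? | yes (i , pi) with Fₚ.any? (λ j → ¬? (i Fₚ.≟ j) ×-dec P? j)
... | no none with fresh (i ∷ []) (ℕₚ.≤-trans (ℕ.s≤s (ℕ.s≤s ℕ.z≤n)) 2<n)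
...   | j , j≢i ∷ [] = inj₂ (i , j , j≢i ∘ sym , only)
  where
  only : ∀ x → P x → x ≡ i ⊎ x ≡ j
  only x px with i Fₚ.≟ x
  ... | yes e = inj₁ (sym e)
  ... | no ne = ⊥-elim (none (x , ne , px))
three-or-two {n} 2<n {P} P? | yes (i , pi) | yes (j , i≢j , pj)
  with Fₚ.any? (λ k → ¬? (i Fₚ.≟ k) ×-dec ¬? (j Fₚ.≟ k) ×-dec P? k)
... | yes (k , i≢k , j≢k , pk) = inj₁ (i , j , k , (i≢j , i≢k , j≢k) , pi , pj , pk)
... | no none = inj₂ (i , j , i≢j , only)
  where
  only : ∀ x → P x → x ≡ i ⊎ x ≡ j
  only x px with i Fₚ.≟ x | j Fₚ.≟ x
  ... | yes e | _     = inj₁ (sym e)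
  ... | no _  | yes e = inj₂ (sym e)
  ... | no ne | no nf = ⊥-elim (none (x , ne , nf , px))

-- This is m(m + 1): at most two points take each value `- k`, and lifting one of them to 1 costs k
-- + 1.
cost : ℕ → ℤ
cost zero    = 0ℤ
cost (suc m) = cost m + + 2 * + suc m

-- W is the weight by which each bₓ ∈ {0, -1, …, 1 - m} must be raised to reach 1.
record Raise {n} (b : Fin n → ℤ) (m : ℕ) : Set where
  field
    W        : Fin n → ℤ
    W-nonneg : ∀ x → 0ℤ ≤ W x
    W-sum    : sum W ≡ cost m
    W-raise  : ∀ k → k ℕ.< m → ∀ x → b x ≡ - (+ k) → + suc k ≤ W x

heavy-or-raise : ∀ {n} (b : Fin n → ℤ) → 2 ℕ.< n → ∀ m → (∃ λ k → k ℕ.< m × Heavy b (- (+ k))) ⊎ Raise b m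
heavy-or-raise {n} b 2<n zero = inj₂ record
  { W = λ _ → 0ℤ ; W-nonneg = λ _ → ℤₚ.≤-refl ; W-sum = sum-replicate-zero n ; W-raise = λ k () }
heavy-or-raise {n} b 2<n (suc m) with heavy-or-raise b 2<n m
... | inj₁ (k , k<m , h) = inj₁ (k , ℕₚ.m<n⇒m<1+n k<m , h)
... | inj₂ r with three-or-two 2<n (λ x → b x ℤₚ.≟ - (+ m))
...   | inj₁ h = inj₁ (m , ℕₚ.n<1+n m , h)
...   | inj₂ (p , q , _ , only) = inj₂ record
  { W        = W′
  ; W-nonneg = λ x → ℤₚ.+-mono-≤ (W-nonneg x) (extra-nonneg x)
  ; W-sum    = begin
      sum W′                                              ≡⟨ ∑-distrib-+ W extra ⟩
      sum W + sum extra                                   ≡⟨ cong₂ _+_ W-sum (∑-distrib-+ (λ x → δ p x * + suc m) _) ⟩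
      cost m + ((sum λ x → δ p x * + suc m) + (sum λ x → δ q x * + suc m))
        ≡⟨ cong (λ z → cost m + z) (cong₂ _+_ (sum-δ p (λ _ → + suc m)) (sum-δ q (λ _ → + suc m))) ⟩
      cost m + (+ suc m + + suc m)                        ≡⟨ cong (λ z → cost m + z) (double (+ suc m)) ⟩
      cost m + + 2 * + suc m                              ∎
  ; W-raise  = raise
  }
  where
  open Raise r
  open ≡-Reasoning
  double : ∀ x → x + x ≡ + 2 * x
  double = solve-∀
  -- Both points receive the weight `suc m`, whether or not they take the value `- m`; this makes
  -- `W-sum` an equality.
  extra W′ : Fin n → ℤ
  extra x = δ p x * + suc m + δ q x * + suc m
  W′ x = W x + extra x
  δ-nonneg : ∀ i x → 0ℤ ≤ δ i x * + suc m
  δ-nonneg i x with i Fₚ.≟ x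
  ... | yes refl rewrite δ-refl i = ℤ.+≤+ ℕ.z≤n
  ... | no  i≢x  rewrite δ-≢ i≢x  = ℤ.+≤+ ℕ.z≤n
  extra-nonneg : ∀ x → 0ℤ ≤ extra x
  extra-nonneg x = ℤₚ.+-mono-≤ (δ-nonneg p x) (δ-nonneg q x)
  δ-hit : ∀ i → + suc m ≤ δ i i * + suc m
  δ-hit i rewrite δ-refl i = ℤₚ.≤-reflexive (sym (ℤₚ.*-identityˡ (+ suc m)))
  raise : ∀ k → k ℕ.< suc m → ∀ x → b x ≡ - (+ k) → + suc k ≤ W′ x
  raise k k<1+m x e with k ℕ.≟ m
  ... | no  k≢m  = ℤₚ.≤-trans (ℤₚ.≤-reflexive (sym (ℤₚ.+-identityʳ (+ suc k))))
                     (ℤₚ.+-mono-≤ (W-raise k (ℕₚ.≤∧≢⇒< (ℕₚ.≤-pred k<1+m) k≢m) x e) (extra-nonneg x))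
  ... | yes refl with only x e
  ...   | inj₁ refl = ℤₚ.+-mono-≤ (W-nonneg x) (ℤₚ.≤-trans (ℤₚ.≤-reflexive (sym (ℤₚ.+-identityʳ (+ suc k))))
                        (ℤₚ.+-mono-≤ (δ-hit x) (δ-nonneg q x)))
  ...   | inj₂ refl = ℤₚ.+-mono-≤ (W-nonneg x) (ℤₚ.+-mono-≤ (δ-nonneg p x) (δ-hit x))

-- At most two bₓ are below -5 and, with a third index, these contribute at least -15 to the sum.
-- If no value in {0, …, -5} were taken three times, raising the remaining bₓ to at least 1 would
-- cost at most 42, so that n ≤ 42 + 3 + 15.
heavy-negative : ∀ {n} {b : Fin n → ℤ} → 63 ℕ.< n → Spread b → ∃ λ k → k ℕ.< 5 × Heavy b -[1+ k ]
heavy-negative {n} {b} 63<n sp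
  with heavy-or-raise b (ℕₚ.<-trans (ℕ.s≤s (ℕ.s≤s (ℕ.s≤s ℕ.z≤n))) 63<n) 6
... | inj₁ (zero , _ , i , j , k , d , p , q , r) =
  ⊥-elim (proj₁ (Spread.admissible sp d) (cong₂ _+_ (cong₂ _+_ p q) r))
... | inj₁ (suc k , ℕ.s≤s k<5 , h) = k , k<5 , h
... | inj₂ r with three-or-two (ℕₚ.<-trans (ℕ.s≤s (ℕ.s≤s (ℕ.s≤s ℕ.z≤n))) 63<n) (λ x → b x ℤₚ.≤? -[1+ 5 ])
...   | inj₁ (i , j , k , d , p , q , r) = ⊥-elim (from-no (-[1+ 14 ] ℤₚ.≤? -[1+ 17 ])
  (ℤₚ.≤-trans (proj₁ (proj₂ (Spread.admissible sp d))) (ℤₚ.+-mono-≤ (ℤₚ.+-mono-≤ p q) r)))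
...   | inj₂ (p , q , p≢q , only) with fresh (p ∷ q ∷ []) (ℕₚ.<-trans (ℕ.s≤s (ℕ.s≤s (ℕ.s≤s ℕ.z≤n))) 63<n)
...   | z , z≢p ∷ z≢q ∷ [] = ⊥-elim (ℕₚ.<⇒≱ 63<n (ℕₚ.≤-trans (ℤₚ.drop‿+≤+ n≤60) (ℕₚ.m≤m+n 60 3)))
  where
  open Spread sp
  open Raise r
  -- `fill` moves the values at `p`, `q` and `z` to exactly 1, and `W` lifts the remaining ones. The
  -- point `z` completes `p` and `q` to a triple, whose sum is bounded below by -15.
  fill f : Fin n → ℤ
  fill x = δ p x * (1ℤ - b p) + (δ q x * (1ℤ - b q) + δ z x * (1ℤ - b z))
  f x = (b x + fill x) + W x
  sum-f : sum f ≡ (0ℤ + ((1ℤ - b p) + ((1ℤ - b q) + (1ℤ - b z)))) + + 42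
  sum-f = trans (∑-distrib-+ (λ x → b x + fill x) W)
    (cong₂ _+_ (trans (∑-distrib-+ b fill) (cong₂ _+_ total
      (trans (∑-distrib-+ (λ x → δ p x * (1ℤ - b p)) _)
      (cong₂ _+_ (sum-δ p (λ _ → 1ℤ - b p))
      (trans (∑-distrib-+ (λ x → δ q x * (1ℤ - b q)) _)
      (cong₂ _+_ (sum-δ q (λ _ → 1ℤ - b q)) (sum-δ z (λ _ → 1ℤ - b z))))))))
      W-sum)
  regroup : ∀ x y z → (0ℤ + ((1ℤ - x) + ((1ℤ - y) + (1ℤ - z)))) + + 42 ≡ + 45 - (x + y + z)
  regroup = solve-∀
  filled : ∀ {x y} → y ≡ 1ℤ → 1ℤ ≤ y + W x
  filled {x} refl = ℤₚ.+-mono-≤ (ℤₚ.≤-refl {1ℤ}) (W-nonneg x)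
  filled₁ : ∀ b c d → b + (1ℤ * (1ℤ - b) + (0ℤ * c + 0ℤ * d)) ≡ 1ℤ
  filled₁ = solve-∀
  filled₂ : ∀ b c d → b + (0ℤ * c + (1ℤ * (1ℤ - b) + 0ℤ * d)) ≡ 1ℤ
  filled₂ = solve-∀
  filled₃ : ∀ b c d → b + (0ℤ * c + (0ℤ * d + 1ℤ * (1ℤ - b))) ≡ 1ℤ
  filled₃ = solve-∀
  unfilled : ∀ b c d e → b + (0ℤ * c + (0ℤ * d + 0ℤ * e)) ≡ b
  unfilled = solve-∀
  raised : ∀ x → x ≢ p → x ≢ q → 1ℤ ≤ b x + W x
  raised x x≢p x≢q with b x in e
  ... | + zero  = ℤₚ.+-mono-≤ (ℤₚ.≤-refl {0ℤ}) (W-raise 0 (ℕ.s≤s ℕ.z≤n) x e)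
  ... | + suc m = ℤₚ.+-mono-≤ (ℤ.+≤+ (ℕ.s≤s ℕ.z≤n)) (W-nonneg x)
  ... | -[1+ m ] with m ℕ.<? 5
  ...   | yes m<5 = ℤₚ.≤-trans (ℤₚ.≤-reflexive (sym (step (+ suc m))))
                      (ℤₚ.+-monoʳ-≤ -[1+ m ] (W-raise (suc m) (ℕ.s≤s m<5) x e))
    where
    step : ∀ y → - y + (1ℤ + y) ≡ 1ℤ
    step = solve-∀
  ...   | no  m≮5 with only x (subst (_≤ -[1+ 5 ]) (sym e) (ℤ.-≤- (ℕₚ.≮⇒≥ m≮5)))
  ...     | inj₁ x≡p = ⊥-elim (x≢p x≡p)
  ...     | inj₂ x≡q = ⊥-elim (x≢q x≡q)
  1≤f : ∀ x → 1ℤ ≤ f x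
  1≤f x with p Fₚ.≟ x
  ... | yes refl rewrite δ-refl p | δ-≢ (p≢q ∘ sym) | δ-≢ z≢p = filled {x} (filled₁ (b p) (1ℤ - b q) (1ℤ - b z))
  ... | no p≢x with q Fₚ.≟ x
  ...   | yes refl rewrite δ-refl q | δ-≢ p≢q | δ-≢ z≢q = filled {x} (filled₂ (b q) (1ℤ - b p) (1ℤ - b z))
  ...   | no q≢x with z Fₚ.≟ x
  ...     | yes refl rewrite δ-refl z | δ-≢ (z≢p ∘ sym) | δ-≢ (z≢q ∘ sym) = filled {x} (filled₃ (b z) (1ℤ - b p) (1ℤ - b q))
  ...     | no z≢x rewrite δ-≢ p≢x | δ-≢ q≢x | δ-≢ z≢x | unfilled (b x) (1ℤ - b p) (1ℤ - b q) (1ℤ - b z) =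
              raised x (p≢x ∘ sym) (q≢x ∘ sym)
  open ℤₚ.≤-Reasoning
  n≤60 : + n ≤ + 60
  n≤60 = begin
    + n                         ≡⟨ sym (ℤₚ.*-identityʳ (+ n)) ⟩
    + n * 1ℤ                    ≡⟨ sym (sum-const n 1ℤ) ⟩
    sum {n} (λ _ → 1ℤ)          ≤⟨ sum-mono 1≤f ⟩
    sum f                       ≡⟨ trans sum-f (regroup (b p) (b q) (b z)) ⟩
    + 45 - (b p + b q + b z)    ≤⟨ ℤₚ.+-monoʳ-≤ (+ 45) (ℤₚ.neg-mono-≤
                                     (proj₁ (proj₂ (admissible (p≢q , z≢p ∘ sym , z≢q ∘ sym))))) ⟩
    + 60                        ∎

-- Values compatible with two heavy ones

avoid : ∀ {n} {b : Fin n → ℤ} {t} → Heavy b t → ∀ x → ∃ λ i → ∃ λ j → i ≢ j × i ≢ x × j ≢ x × b i ≡ t × b j ≡ t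
avoid (i , j , k , (i≢j , i≢k , j≢k) , p , q , r) x with i Fₚ.≟ x | j Fₚ.≟ x
... | yes refl | _        = j , k , j≢k , i≢j ∘ sym , i≢k ∘ sym , q , r
... | no  i≢x  | yes refl = i , k , i≢k , i≢x , j≢k ∘ sym , p , r
... | no  i≢x  | no  j≢x  = i , j , i≢j , i≢x , j≢x , p , q

heavy-heavy : ∀ {n} {b : Fin n → ℤ} → Spread b → ∀ {t} → Heavy b t → ∀ x → Admissible (t + t + b x)
heavy-heavy {b = b} sp h x with avoid h x
... | i , j , i≢j , i≢x , j≢x , refl , q =
  subst (λ z → Admissible (b i + z + b x)) q (Spread.admissible sp (i≢j , i≢x , j≢x))

heavy-mixed : ∀ {n} {b : Fin n → ℤ} → Spread b → ∀ {t s} → t ≢ s → Heavy b t → Heavy b s →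
              ∀ x → Admissible (t + s + b x)
heavy-mixed {b = b} sp t≢s h g x with avoid h x | avoid g x
... | i , _ , _ , i≢x , _ , refl , _ | j , _ , _ , j≢x , _ , refl , _ =
  Spread.admissible sp ((λ e → t≢s (cong b e)) , i≢x , j≢x)

multiple⇒%≡0 : ∀ m {n} .{{_ : ℕ.NonZero m}} c → + n ≡ + m * c → n % m ≡ 0
multiple⇒%≡0 m {n} c e = trans (cong (_% m) (trans (cong ℤ.∣_∣ e) (trans (ℤₚ.abs-* (+ m) c) (ℕₚ.*-comm m ℤ.∣ c ∣))))
                           (DM.m*n%n≡0 ℤ.∣ c ∣ m)

mod9-six : ∀ {n} c → + n ≡ + 6 + + 9 * c → n % 9 ≡ 6
mod9-six {n} (+ k) e = trans (cong (_% 9) (ℤₚ.+-injective (trans e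
    (cong (λ z → + 6 + z) (trans (sym (ℤₚ.pos-* 9 k)) (cong +_ (ℕₚ.*-comm 9 k))))))) (DM.[m+kn]%n≡m%n 6 k 9)
-- For negative `c` the right side is -(3 + 9k), which is no natural number.
mod9-six {n} -[1+ k ] e with trans e (eq (+ k))
  where
  eq : ∀ k → + 6 + + 9 * (- (1ℤ + k)) ≡ - (+ 3 + + 9 * k)
  eq = solve-∀
... | e′ with trans e′ (cong (λ z → - (+ 3 + z)) (sym (ℤₚ.pos-* 9 k)))
...   | ()

∃-fin : ∀ {m} d → 0ℤ ≤ d → d ≤ + m → ∃ λ (e : Fin (suc m)) → d ≡ + F.toℕ e
∃-fin (+ d) _ (ℤ.+≤+ d≤m) = F.fromℕ< (ℕ.s≤s d≤m) , cong +_ (sym (Fₚ.toℕ-fromℕ< (ℕ.s≤s d≤m)))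
∃-fin -[1+ d ] () _

+-cancelˡ-≤ : ∀ a x y → a + x ≤ a + y → x ≤ y
+-cancelˡ-≤ a x y h = ℤₚ.0≤i-j⇒j≤i (subst (0ℤ ≤_) (cancel a x y) (ℤₚ.i≤j⇒0≤j-i h))
  where
  cancel : ∀ a x y → (a + y) - (a + x) ≡ y - x
  cancel = solve-∀

-- The constraint from `t + t` is attained at `c` and the one from `s + s` at `c + 3 m`. Between
-- them the residue class modulo 3 has `suc m` members, listed by `Fin` for case analysis.
residue-range : ∀ (t s c : ℤ) {m y} → (t + t) + c ≡ -[1+ 14 ] → (s + s) + (c + + 3 * + m) ≡ + 15 →
                (∃ λ d → y ≡ c + + 3 * d) → Admissible (t + t + y) → Admissible (s + s + y) →
                ∃ λ (e : Fin (suc m)) → y ≡ c + + 3 * + F.toℕ e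
residue-range t s c {m} low high (d , refl) (_ , l , _) (_ , _ , u) = map₂ (cong (λ z → c + + 3 * z)) (∃-fin d
  (ℤₚ.*-cancelˡ-≤-pos 0ℤ d (+ 3) (+-cancelˡ-≤ (t + t + c) 0ℤ (+ 3 * d) (begin
    t + t + c + 0ℤ        ≡⟨ trans (ℤₚ.+-identityʳ (t + t + c)) low ⟩
    -[1+ 14 ]             ≤⟨ l ⟩
    t + t + (c + + 3 * d) ≡⟨ sym (ℤₚ.+-assoc (t + t) c (+ 3 * d)) ⟩
    t + t + c + + 3 * d   ∎)))
  (ℤₚ.*-cancelˡ-≤-pos d (+ m) (+ 3) (+-cancelˡ-≤ (s + s + c) (+ 3 * d) (+ 3 * + m) (begin
    s + s + c + + 3 * d     ≡⟨ ℤₚ.+-assoc (s + s) c (+ 3 * d) ⟩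
    s + s + (c + + 3 * d)   ≤⟨ u ⟩
    + 15                    ≡⟨ sym high ⟩
    s + s + (c + + 3 * + m) ≡⟨ sym (ℤₚ.+-assoc (s + s) c (+ 3 * + m)) ⟩
    s + s + c + + 3 * + m   ∎))))
  where open ℤₚ.≤-Reasoning

sum-affine : ∀ {n} {b : Fin n → ℤ} c m (d : Fin n → ℤ) → (∀ x → b x ≡ c + m * d x) → sum b ≡ + n * c + m * sum d
sum-affine {n} c m d b≡ = trans (sum-cong-≗ b≡) (trans (∑-distrib-+ (λ _ → c) (λ x → m * d x))
  (cong₂ _+_ (sum-const n c) (sum-*ˡ m d)))

Congruent : ∀ {n} → (Fin n → ℤ) → Set
Congruent b = ∀ i j → ∃ λ d → b i ≡ b j + + 3 * d

mod-heavy : ∀ {n} {b : Fin n → ℤ} {t} → Congruent b → Heavy b t → ∀ x → ∃ λ d → b x ≡ t + + 3 * d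
mod-heavy cong3 (i , _ , _ , _ , refl , _) x = cong3 x i

-- For (t , s) = (-5 , 1) and (-3 , 3) every bₓ lies in c + 6 ℤ with c odd, c the least value allowed.
even-case : ∀ {n} {b : Fin n → ℤ} → Spread b → ∀ (t s c c′ : ℤ) → t ≢ s → c ≡ 1ℤ + + 2 * c′ →
  (t + t) + c ≡ -[1+ 14 ] → (s + s) + (c + + 18) ≡ + 15 →
  (s + s) + (c + + 3) ≡ 0ℤ → (t + s) + (c + + 9) ≡ 0ℤ → (t + t) + (c + + 15) ≡ 0ℤ →
  (∀ x → ∃ λ d → b x ≡ c + + 3 * d) → Heavy b t → Heavy b s → n % 2 ≡ 0
even-case {n} {b} sp t s c c′ t≢s odd low high e₁ e₃ e₅ b≡ h g =
  multiple⇒%≡0 2 (- (+ 3 * sum k) - + n * c′) (begin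
    + n                                                      ≡⟨ expand (+ n) c′ (sum k) ⟩
    (+ n * (1ℤ + + 2 * c′) + + 6 * sum k) + + 2 * (- (+ 3 * sum k) - + n * c′)
      ≡⟨ cong (λ z → z + + 2 * (- (+ 3 * sum k) - + n * c′)) vanishing ⟩
    0ℤ + + 2 * (- (+ 3 * sum k) - + n * c′)                  ≡⟨ ℤₚ.+-identityˡ _ ⟩
    + 2 * (- (+ 3 * sum k) - + n * c′)                       ∎)
  where
  open ≡-Reasoning
  expand : ∀ n c k → n ≡ (n * (1ℤ + + 2 * c) + + 6 * k) + + 2 * (- (+ 3 * k) - n * c)
  expand = solve-∀
  forbid : ∀ a {y z} {A : Set} → y ≡ z → Admissible (a + y) → a + z ≡ 0ℤ → A
  forbid _ refl (≢0 , _) ≡0 = ⊥-elim (≢0 ≡0)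
  -- The values c + 3, c + 9 and c + 15 would produce a zero entry together with `s + s`, `t + s`
  -- and `t + t` respectively. What remains is c, c + 6, c + 12 and c + 18.
  residue : ∀ x → ∃ λ k → b x ≡ c + + 6 * k
  residue x with residue-range t s c {6} low high (b≡ x) (heavy-heavy sp h x) (heavy-heavy sp g x)
  ... | 0F , e = 0ℤ  , e
  ... | 1F , e = forbid (s + s) e (heavy-heavy sp g x) e₁
  ... | 2F , e = 1ℤ  , e
  ... | 3F , e = forbid (t + s) e (heavy-mixed sp t≢s h g x) e₃
  ... | 4F , e = + 2 , e
  ... | 5F , e = forbid (t + t) e (heavy-heavy sp h x) e₅
  ... | 6F , e = + 3 , e
  k : Fin n → ℤ
  k x = proj₁ (residue x)
  vanishing : + n * (1ℤ + + 2 * c′) + + 6 * sum k ≡ 0ℤ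
  vanishing = trans (cong (λ z → + n * z + + 6 * sum k) (sym odd))
    (trans (sym (sum-affine c (+ 6) k (λ x → proj₂ (residue x)))) (Spread.total sp))

sum-unique : ∀ {n} (e : Fin n → ℤ) → (∀ x → e x ≡ 0ℤ ⊎ e x ≡ 1ℤ) → (∀ {x y} → x ≢ y → e x ≡ 1ℤ → e y ≢ 1ℤ) →
             sum e ≡ 0ℤ ⊎ sum e ≡ 1ℤ
sum-unique e e∈01 unique with Fₚ.any? (λ x → e x ℤₚ.≟ 1ℤ)
... | no none = inj₁ (sum-zero e zeros)
  where
  zeros : ∀ x → e x ≡ 0ℤ
  zeros x with e∈01 x
  ... | inj₁ p = p
  ... | inj₂ p = ⊥-elim (none (x , p))
... | yes (x , ex) = inj₂ (trans (sum-cong-≗ e≡δ) (sum-δ x (λ _ → 1ℤ)))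
  where
  e≡δ : ∀ y → e y ≡ δ x y * 1ℤ
  e≡δ y with x Fₚ.≟ y
  ... | yes refl rewrite δ-refl x = ex
  ... | no  x≢y  rewrite δ-≢ x≢y with e∈01 y
  ...   | inj₁ p = p
  ...   | inj₂ p = ⊥-elim (unique x≢y ex p)

-- For (t , s) = (-5 , 4) the values are -5, 4 ≡ 4 and at most one of -2, 7 ≡ 7 modulo 9.
mod9-case : ∀ {n} {b : Fin n → ℤ} → Spread b → Congruent b → Heavy b -[1+ 4 ] → Heavy b (+ 4) →
  n % 9 ≡ 0 ⊎ n % 9 ≡ 6
mod9-case {n} {b} sp cong3 h@(i , _ , _ , _ , bi , _) g@(j , _ , _ , _ , bj , _) =
  conclude (sum-unique e e∈01 unique)
  where
  -- The indices are the `k` and `e` of y = -5 + 9k + 3e, so `e` marks the exceptional values -2 and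
  -- 7.
  data Form (y : ℤ) : ℤ → ℤ → Set where
    -5F : y ≡ -[1+ 4 ] → Form y 0ℤ 0ℤ
    -2F : y ≡ -[1+ 1 ] → Form y 0ℤ 1ℤ
    4F′ : y ≡ + 4      → Form y 1ℤ 0ℤ
    7F′ : y ≡ + 7      → Form y 1ℤ 1ℤ
  form : ∀ x → ∃ λ k → ∃ λ e → Form (b x) k e
  form x with residue-range -[1+ 4 ] (+ 4) -[1+ 4 ] {4} refl refl
              (mod-heavy {b = b} cong3 h x)
              (heavy-heavy sp h x) (heavy-heavy sp g x)
  ... | 0F , p = _ , _ , -5F p
  ... | 1F , p = _ , _ , -2F p
  -- This is the value 1, and -5 + 4 + 1 = 0.
  ... | 2F , p = ⊥-elim (proj₁ (heavy-mixed sp (λ ()) h g x) (cong (λ y → -[1+ 4 ] + + 4 + y) p))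
  ... | 3F , p = _ , _ , 4F′ p
  ... | 4F , p = _ , _ , 7F′ p
  k e : Fin n → ℤ
  k x = proj₁ (form x)
  e x = proj₁ (proj₂ (form x))
  e∈01 : ∀ x → e x ≡ 0ℤ ⊎ e x ≡ 1ℤ
  e∈01 x with form x
  ... | _ , _ , -5F _ = inj₁ refl
  ... | _ , _ , -2F _ = inj₂ refl
  ... | _ , _ , 4F′ _ = inj₁ refl
  ... | _ , _ , 7F′ _ = inj₂ refl
  sum-of : ∀ {x y z u v w} → b x ≡ u → b y ≡ v → b z ≡ w → u ≢ w → v ≢ w → x ≢ y → Admissible (u + v + w)
  sum-of refl refl refl u≢w v≢w x≢y = Spread.admissible sp (x≢y , (λ p → u≢w (cong b p)) , (λ p → v≢w (cong b p)))
  -- Two exceptional points are ruled out by -2 - 2 + 4 = 0, by -2 + 7 - 5 = 0 and by 7 + 7 + 4 = 18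
  -- > 15; the third summand comes from a heavy value.
  unique : ∀ {x y} → x ≢ y → e x ≡ 1ℤ → e y ≢ 1ℤ
  unique {x} {y} x≢y with form x | form y
  ... | _ , _ , -5F _ | _             = λ ()
  ... | _ , _ , 4F′ _ | _             = λ ()
  ... | _ , _ , -2F _ | _ , _ , -5F _ = λ _ ()
  ... | _ , _ , -2F _ | _ , _ , 4F′ _ = λ _ ()
  ... | _ , _ , 7F′ _ | _ , _ , -5F _ = λ _ ()
  ... | _ , _ , 7F′ _ | _ , _ , 4F′ _ = λ _ ()
  ... | _ , _ , -2F p | _ , _ , -2F q = λ _ _ → proj₁ (sum-of p q bj (λ ()) (λ ()) x≢y) refl
  ... | _ , _ , -2F p | _ , _ , 7F′ q = λ _ _ → proj₁ (sum-of p q bi (λ ()) (λ ()) x≢y) refl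
  ... | _ , _ , 7F′ p | _ , _ , -2F q = λ _ _ → proj₁ (sum-of p q bi (λ ()) (λ ()) x≢y) refl
  ... | _ , _ , 7F′ p | _ , _ , 7F′ q = λ _ _ → from-no (+ 18 ℤₚ.≤? + 15) (proj₂ (proj₂ (sum-of p q bj (λ ()) (λ ()) x≢y)))
  Form-value : ∀ {y k e} → Form y k e → y ≡ -[1+ 4 ] + + 3 * (+ 3 * k + e)
  Form-value (-5F p) = p
  Form-value (-2F p) = p
  Form-value (4F′ p) = p
  Form-value (7F′ p) = p
  vanishing : + n * -[1+ 4 ] + + 3 * (+ 3 * sum k + sum e) ≡ 0ℤ
  vanishing = begin
    + n * -[1+ 4 ] + + 3 * (+ 3 * sum k + sum e)
      ≡⟨ cong (λ z → + n * -[1+ 4 ] + + 3 * z) (sym (trans (∑-distrib-+ (λ x → + 3 * k x) e) (cong (λ z → z + sum e) (sum-*ˡ (+ 3) k)))) ⟩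
    + n * -[1+ 4 ] + + 3 * sum (λ x → + 3 * k x + e x)
      ≡⟨ sym (sum-affine -[1+ 4 ] (+ 3) (λ x → + 3 * k x + e x) (λ x → Form-value (proj₂ (proj₂ (form x))))) ⟩
    sum b ≡⟨ Spread.total sp ⟩
    0ℤ ∎
    where open ≡-Reasoning
  -- The factor -2 inverts -5 modulo 9, which solves -5n + 9k + 3e = 0 for n modulo 9.
  expand : ∀ n k e → n ≡ (+ 6 * e + + 9 * (+ 2 * k - n)) - + 2 * (n * -[1+ 4 ] + + 3 * (+ 3 * k + e))
  expand = solve-∀
  n-value : ∀ {z} → sum e ≡ z → + n ≡ (+ 6 * z + + 9 * (+ 2 * sum k - + n)) - 0ℤ
  n-value refl = trans (expand (+ n) (sum k) (sum e))
    (cong (λ z → (+ 6 * sum e + + 9 * (+ 2 * sum k - + n)) - + 2 * z) vanishing)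
  drop₀ : ∀ z → (+ 6 * 0ℤ + z) - 0ℤ ≡ z
  drop₀ = solve-∀
  drop₁ : ∀ z → (+ 6 * 1ℤ + z) - 0ℤ ≡ + 6 + z
  drop₁ = solve-∀
  conclude : sum e ≡ 0ℤ ⊎ sum e ≡ 1ℤ → n % 9 ≡ 0 ⊎ n % 9 ≡ 6
  conclude (inj₁ p) = inj₁ (multiple⇒%≡0 9 (+ 2 * sum k - + n) (trans (n-value p) (drop₀ (+ 9 * (+ 2 * sum k - + n)))))
  conclude (inj₂ p) = inj₂ (mod9-six (+ 2 * sum k - + n) (trans (n-value p) (drop₁ (+ 9 * (+ 2 * sum k - + n)))))

data HeavyPair : ℤ → ℤ → Set where
  ⟨-5,1⟩ : HeavyPair -[1+ 4 ] (+ 1)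
  ⟨-1,5⟩ : HeavyPair -[1+ 0 ] (+ 5)
  ⟨-3,3⟩ : HeavyPair -[1+ 2 ] (+ 3)
  ⟨-5,4⟩ : HeavyPair -[1+ 4 ] (+ 4)
  ⟨-4,5⟩ : HeavyPair -[1+ 3 ] (+ 5)

-- `(2 ℕ.+ k ℕ.+ l) % 3 ≡ 0` is t ≡ s mod 3. It leaves nine of the 25 pairs, and in four of these 2t
-- + s or t + 2s is 0.
heavyPair : ∀ k l → k ℕ.< 5 → l ℕ.< 5 → (2 ℕ.+ k ℕ.+ l) % 3 ≡ 0 →
            -[1+ k ] + -[1+ k ] + + suc l ≢ 0ℤ → + suc l + + suc l + -[1+ k ] ≢ 0ℤ → HeavyPair -[1+ k ] (+ suc l)
heavyPair 0 0 _ _ ()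
heavyPair 0 1 _ _ _ ≢0 _ = ⊥-elim (≢0 refl)
heavyPair 0 2 _ _ ()
heavyPair 0 3 _ _ ()
heavyPair 0 4 _ _ _ _ _ = ⟨-1,5⟩
heavyPair 1 0 _ _ _ _ ≢0 = ⊥-elim (≢0 refl)
heavyPair 1 1 _ _ ()
heavyPair 1 2 _ _ ()
heavyPair 1 3 _ _ _ ≢0 _ = ⊥-elim (≢0 refl)
heavyPair 1 4 _ _ ()
heavyPair 2 0 _ _ ()
heavyPair 2 1 _ _ ()
heavyPair 2 2 _ _ _ _ _ = ⟨-3,3⟩
heavyPair 2 3 _ _ ()
heavyPair 2 4 _ _ ()
heavyPair 3 0 _ _ ()
heavyPair 3 1 _ _ _ _ ≢0 = ⊥-elim (≢0 refl)
heavyPair 3 2 _ _ ()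
heavyPair 3 3 _ _ ()
heavyPair 3 4 _ _ _ _ _ = ⟨-4,5⟩
heavyPair 4 0 _ _ _ _ _ = ⟨-5,1⟩
heavyPair 4 1 _ _ ()
heavyPair 4 2 _ _ ()
heavyPair 4 3 _ _ _ _ _ = ⟨-5,4⟩
heavyPair 4 4 _ _ ()
heavyPair (suc (suc (suc (suc (suc _))))) _ (ℕ.s≤s (ℕ.s≤s (ℕ.s≤s (ℕ.s≤s (ℕ.s≤s ())))))
heavyPair 0 (suc (suc (suc (suc (suc _))))) _ (ℕ.s≤s (ℕ.s≤s (ℕ.s≤s (ℕ.s≤s (ℕ.s≤s ())))))
heavyPair 1 (suc (suc (suc (suc (suc _))))) _ (ℕ.s≤s (ℕ.s≤s (ℕ.s≤s (ℕ.s≤s (ℕ.s≤s ())))))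
heavyPair 2 (suc (suc (suc (suc (suc _))))) _ (ℕ.s≤s (ℕ.s≤s (ℕ.s≤s (ℕ.s≤s (ℕ.s≤s ())))))
heavyPair 3 (suc (suc (suc (suc (suc _))))) _ (ℕ.s≤s (ℕ.s≤s (ℕ.s≤s (ℕ.s≤s (ℕ.s≤s ())))))
heavyPair 4 (suc (suc (suc (suc (suc _))))) _ (ℕ.s≤s (ℕ.s≤s (ℕ.s≤s (ℕ.s≤s (ℕ.s≤s ())))))

-- An odd n forces the pair (-5 , 4) or its negative.
Conclusion : ∀ {n} → (Fin n → ℤ) → Set
Conclusion {n} b = ∃ λ t → Heavy b t × 3 ℕ.≤ ℤ.∣ t ∣ × (n % 2 ≢ 0 → 5 ℕ.≤ ℤ.∣ t ∣ × (n % 9 ≡ 0 ⊎ n % 9 ≡ 6))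

conclusion-neg : ∀ {n} {b : Fin n → ℤ} → Conclusion (λ i → - b i) → Conclusion b
conclusion-neg {n} {b} (t , h , 3≤ , odd) = - t , heavy-neg h ,
  subst (λ m → 3 ℕ.≤ m × (n % 2 ≢ 0 → 5 ℕ.≤ m × (n % 9 ≡ 0 ⊎ n % 9 ≡ 6))) (sym (ℤₚ.∣-i∣≡∣i∣ t)) (3≤ , odd)

congruent-neg : ∀ {n} {b : Fin n → ℤ} → Congruent b → Congruent (λ i → - b i)
congruent-neg {b = b} c i j = - proj₁ (c i j) , trans (cong (λ z → - z) (proj₂ (c i j))) (neg (b j) (proj₁ (c i j)))
  where
  neg : ∀ x d → - (x + + 3 * d) ≡ - x + + 3 * (- d)
  neg = solve-∀

neg-heavy : ∀ {n} {b : Fin n → ℤ} {t} → Heavy b t → Heavy (λ i → - b i) (- t)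
neg-heavy (i , j , k , d , p , q , r) = i , j , k , d , cong (λ z → - z) p , cong (λ z → - z) q , cong (λ z → - z) r

conclude-pair : ∀ {n} {b : Fin n → ℤ} → Spread b → Congruent b → ∀ {t s} → HeavyPair t s → Heavy b t → Heavy b s → Conclusion b
conclude-pair {b = b} sp cong3 ⟨-5,1⟩ h g = _ , h , 3≤5 , λ odd → ⊥-elim (odd
  (even-case sp -[1+ 4 ] (+ 1) -[1+ 4 ] -[1+ 2 ] (λ ()) refl refl refl refl refl refl (mod-heavy cong3 h) h g))
  where
  3≤5 : 3 ℕ.≤ 5
  3≤5 = ℕ.s≤s (ℕ.s≤s (ℕ.s≤s ℕ.z≤n))
conclude-pair {b = b} sp cong3 ⟨-3,3⟩ h g = _ , h , ℕₚ.≤-refl , λ odd → ⊥-elim (odd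
  (even-case sp -[1+ 2 ] (+ 3) -[1+ 8 ] -[1+ 4 ] (λ ()) refl refl refl refl refl refl shifted h g))
  where
  -- Here the least allowed value is not t = -3 but -9, since 2 · (-3) - 9 = -15.
  shift : ∀ d → -[1+ 2 ] + + 3 * d ≡ -[1+ 8 ] + + 3 * (+ 2 + d)
  shift = solve-∀
  shifted : ∀ x → ∃ λ d → b x ≡ -[1+ 8 ] + + 3 * d
  shifted x with mod-heavy cong3 h x
  ... | d , e = + 2 + d , trans e (shift d)
conclude-pair sp cong3 ⟨-5,4⟩ h g = _ , h , ℕ.s≤s (ℕ.s≤s (ℕ.s≤s ℕ.z≤n)) , λ _ → ℕₚ.≤-refl , mod9-case sp cong3 h g
conclude-pair sp cong3 ⟨-1,5⟩ h g = conclusion-neg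
  (conclude-pair (spread-neg sp) (congruent-neg cong3) ⟨-5,1⟩ (neg-heavy g) (neg-heavy h))
conclude-pair sp cong3 ⟨-4,5⟩ h g = conclusion-neg
  (conclude-pair (spread-neg sp) (congruent-neg cong3) ⟨-5,4⟩ (neg-heavy g) (neg-heavy h))

-- The positive heavy value is a negative one of `- b`.
heavy-values : ∀ {n} {b : Fin n → ℤ} → 63 ℕ.< n → Spread b → Congruent b → Conclusion b
heavy-values {b = b} 63<n sp cong3 with heavy-negative 63<n sp | heavy-negative 63<n (spread-neg sp)
... | k , k<5 , h@(i , _ , _ , _ , bi , _) | l , l<5 , g′ with heavy-neg g′
...   | g@(j , _ , _ , _ , bj , _) = conclude-pair sp cong3
  (heavyPair k l k<5 l<5 sum≡0
    (λ e → proj₁ (heavy-heavy sp h j) (trans (cong (λ z → -[1+ k ] + -[1+ k ] + z) bj) e))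
    (λ e → proj₁ (heavy-heavy sp g i) (trans (cong (λ z → + suc l + + suc l + z) bi) e)))
  h g
  where
  open ≡-Reasoning
  d : ℤ
  d = proj₁ (cong3 j i)
  insert : ∀ k l → + 2 + k + l ≡ (1ℤ + l) - (- (1ℤ + k))
  insert = solve-∀
  cancel : ∀ a d → (a + d) - a ≡ d
  cancel = solve-∀
  multiple : + (2 ℕ.+ k ℕ.+ l) ≡ + 3 * d
  multiple = begin
    + (2 ℕ.+ k ℕ.+ l)               ≡⟨ insert (+ k) (+ l) ⟩
    + suc l - -[1+ k ]              ≡⟨ cong₂ _-_ (sym bj) (sym bi) ⟩
    b j - b i                       ≡⟨ cong (_- b i) (proj₂ (cong3 j i)) ⟩
    (b i + + 3 * d) - b i           ≡⟨ cancel (b i) (+ 3 * d) ⟩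
    + 3 * d                         ∎
  sum≡0 : (2 ℕ.+ k ℕ.+ l) % 3 ≡ 0
  sum≡0 = multiple⇒%≡0 3 d multiple

-- The maximum norm and the constraints on small eigenvectors

foldSub-⊔-upper : ∀ {n} (f : Subset n → ℕ) U → f U ℕ.≤ foldSub ℕ._⊔_ f
foldSub-⊔-upper {zero}  f []            = ℕₚ.≤-refl
foldSub-⊔-upper {suc n} f (inside  ∷ U) = ℕₚ.≤-trans (foldSub-⊔-upper (f ∘ (inside ∷_)) U) (ℕₚ.m≤m⊔n _ _)
foldSub-⊔-upper {suc n} f (outside ∷ U) = ℕₚ.≤-trans (foldSub-⊔-upper (f ∘ (outside ∷_)) U) (ℕₚ.m≤n⊔m _ _)

foldSub-⊔-least : ∀ {n} (f : Subset n → ℕ) {M} → (∀ U → f U ℕ.≤ M) → foldSub ℕ._⊔_ f ℕ.≤ M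
foldSub-⊔-least {zero}  f f≤M = f≤M []
foldSub-⊔-least {suc n} f f≤M = ℕₚ.⊔-lub (foldSub-⊔-least _ (f≤M ∘ (inside ∷_))) (foldSub-⊔-least _ (f≤M ∘ (outside ∷_)))

supNorm-extend : ∀ {n} (v : Vertex n 3 → ℤ) → supNorm n 3 v ≡ foldSub ℕ._⊔_ (λ U → ℤ.∣ extend v U ∣)
supNorm-extend {n} v = foldSub-cong ℕ._⊔_ pointwise
  where
  entry : ∃ λ g → supNorm n 3 v ≡ foldSub ℕ._⊔_ g
  entry = _ , refl
  pointwise : ∀ U → proj₁ entry U ≡ ℤ.∣ extend v U ∣
  pointwise U with ∣ U ∣ ℕ.≟ 3
  ... | yes _ = refl
  ... | no  _ = refl

supNorm-upper : ∀ {n} (v : Vertex n 3 → ℤ) x → ℤ.∣ v x ∣ ℕ.≤ supNorm n 3 v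
supNorm-upper v (S , p) rewrite supNorm-extend v | extend-vertex v S p = foldSub-⊔-upper (λ U → ℤ.∣ extend v U ∣) S

supNorm-least : ∀ {n} (v : Vertex n 3 → ℤ) {M} → (∀ x → ℤ.∣ v x ∣ ℕ.≤ M) → supNorm n 3 v ℕ.≤ M
supNorm-least v {M} v≤M rewrite supNorm-extend v = foldSub-⊔-least (λ U → ℤ.∣ extend v U ∣) entry
  where
  entry : ∀ U → ℤ.∣ extend v U ∣ ℕ.≤ M
  entry U with ∣ U ∣ ℕ.≟ 3
  ... | yes p = v≤M (U , p)
  ... | no  _ = ℕ.z≤n

∣∣≤⇒bounds : ∀ {z m} → ℤ.∣ z ∣ ℕ.≤ suc m → -[1+ m ] ≤ z × z ≤ + suc m
∣∣≤⇒bounds {+ z}      h           = ℤ.-≤+ , ℤ.+≤+ h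
∣∣≤⇒bounds { -[1+ z ]} (ℕ.s≤s h) = ℤ.-≤- h , ℤ.-≤+

sup-constraints : ∀ {n} → 63 ℕ.< n → ∀ u → NowhereZero n 3 u → IsEigenvector n 3 (theta1 n 3) u →
  supNorm n 3 u ℕ.≤ 5 →
  3 ℕ.≤ supNorm n 3 u × (n % 2 ≢ 0 → 5 ℕ.≤ supNorm n 3 u × (n % 9 ≡ 0 ⊎ n % 9 ≡ 6))
sup-constraints {n} 63<n u u≢0 (_ , eigen) sup≤5 = conclude (heavy-values 63<n spread b-mod3)
  where
  4<n : 4 ℕ.< n
  4<n = ℕₚ.≤-trans (ℕₚ.m≤m+n 5 59) 63<n
  open Weights (weights 4<n (eigentriple u (ℕₚ.<⇒≤ 4<n) eigen))
  at : ∀ {i j k} → Distinct i j k → ℤ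
  at {i} {j} {k} d = u (triple i j k , ∣triple∣ d)
  at-weights : ∀ {i j k} (d : Distinct i j k) → + 3 * at d ≡ b i + b j + b k
  at-weights {i} {j} {k} d = trans (cong (λ z → + 3 * z) (extend-vertex u (triple i j k) (∣triple∣ d))) (b-triple d)
  at≤sup : ∀ {i j k} (d : Distinct i j k) → ℤ.∣ at d ∣ ℕ.≤ supNorm n 3 u
  at≤sup {i} {j} {k} d = supNorm-upper u (triple i j k , ∣triple∣ d)
  spread : Spread b
  spread = record
    { total      = b-sum
    ; admissible = λ {i} {j} {k} d → subst Admissible (at-weights d)
        ( (λ e → u≢0 (triple i j k , ∣triple∣ d) (ℤₚ.*-cancelˡ-≡ (+ 3) (at d) 0ℤ e))
        , ∣∣≤⇒bounds (subst (ℕ._≤ 15) (sym (ℤₚ.abs-* (+ 3) (at d))) (ℕₚ.*-monoʳ-≤ 3 (ℕₚ.≤-trans (at≤sup d) sup≤5))))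
    }
  thrice : ∀ t → t + t + t ≡ + 3 * t
  thrice = solve-∀
  conclude : Conclusion b → 3 ℕ.≤ supNorm n 3 u × (n % 2 ≢ 0 → 5 ℕ.≤ supNorm n 3 u × (n % 9 ≡ 0 ⊎ n % 9 ≡ 6))
  conclude (t , (i , j , k , d , p , q , r) , 3≤t , odd) =
    ℕₚ.≤-trans 3≤t t≤sup , λ n-odd → ℕₚ.≤-trans (proj₁ (odd n-odd)) t≤sup , proj₂ (odd n-odd)
    where
    -- The three points carrying the heavy value form a vertex whose entry is `t` itself.
    at≡t : at d ≡ t
    at≡t = ℤₚ.*-cancelˡ-≡ (+ 3) (at d) t (trans (at-weights d) (trans (cong₂ _+_ (cong₂ _+_ p q) r) (thrice t)))
    t≤sup : ℤ.∣ t ∣ ℕ.≤ supNorm n 3 u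
    t≤sup = subst (λ z → ℤ.∣ z ∣ ℕ.≤ supNorm n 3 u) at≡t (at≤sup d)

-- Eigenvectors built from integer weights

sumOver-+ : ∀ {n} (p : Subset n) f g → sumOver p (λ x → f x + g x) ≡ sumOver p f + sumOver p g
sumOver-+ p f g = trans (sum-cong-≗ (λ x → when-+ (lookup p x) (f x) (g x)))
  (∑-distrib-+ (λ x → when (lookup p x) (f x)) (λ x → when (lookup p x) (g x)))

sumOver-*ˡ : ∀ {n} (p : Subset n) m f → sumOver p (λ x → m * f x) ≡ m * sumOver p f
sumOver-*ˡ p m f = trans (sum-cong-≗ (λ x → when-* (lookup p x) (f x))) (sum-*ˡ m (λ x → when (lookup p x) (f x)))
  where
  when-* : ∀ b z → when b (m * z) ≡ m * when b z
  when-* true  z = refl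
  when-* false z = sym (ℤₚ.*-zeroʳ m)

sumOver-const : ∀ {n} (p : Subset n) c → sumOver p (λ _ → c) ≡ + ∣ p ∣ * c
sumOver-const []            c = sym (ℤₚ.*-zeroˡ c)
sumOver-const (inside  ∷ p) c = trans (cong (λ z → c + z) (sumOver-const p c)) (sym (ℤₚ.suc-* (+ ∣ p ∣) c))
sumOver-const (outside ∷ p) c = trans (ℤₚ.+-identityˡ _) (sumOver-const p c)

sumOver-outside : ∀ {n} (p : Subset n) f → (sum λ x → when (not (lookup p x)) (f x)) ≡ sum f - sumOver p f
sumOver-outside p f = begin
  sum rest                             ≡⟨ cancel (sum rest) (sumOver p f) ⟩
  (sum rest + sumOver p f) - sumOver p f ≡⟨ cong (_- sumOver p f) (sym (∑-distrib-+ rest (λ x → when (lookup p x) (f x)))) ⟩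
  (sum λ x → rest x + when (lookup p x) (f x)) - sumOver p f
                                       ≡⟨ cong (_- sumOver p f) (sum-cong-≗ λ x → both (lookup p x) (f x)) ⟩
  sum f - sumOver p f                  ∎
  where
  open ≡-Reasoning
  rest : Fin _ → ℤ
  rest x = when (not (lookup p x)) (f x)
  cancel : ∀ x y → x ≡ (x + y) - y
  cancel = solve-∀
  both : ∀ b z → when (not b) z + when b z ≡ z
  both true  z = ℤₚ.+-identityˡ z
  both false z = ℤₚ.+-identityʳ z

sumOver-remove : ∀ {n} (p : Subset n) i f → lookup p i ≡ inside →
                 sumOver p f ≡ f i + sumOver (p [ i ]≔ outside) f
sumOver-remove p i f i∈p = trans (cong (λ q → sumOver q f) (sym reinserted))
  (sumOver-insert (p [ i ]≔ outside) i f (lookup∘update i p outside))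
  where
  reinserted : p [ i ]≔ outside [ i ]≔ inside ≡ p
  reinserted = trans ([]≔-idempotent p i) ([]≔-self p i i∈p)

-- On 3-subsets these are the coordinates aᵢ = cᵢ + r/3, so the thirds are hidden in the constant
-- `r`. The condition Σ aᵢ = 0 becomes n r + 3 Σ cᵢ = 0.
weighted : ∀ {n} → ℤ → (Fin n → ℤ) → Subset n → ℤ
weighted r c S = r + sumOver S c

weighted-swap : ∀ {n} r (c : Fin n → ℤ) S {x y} → lookup S y ≡ inside → lookup S x ≡ outside →
                weighted r c (S [ y ]≔ outside [ x ]≔ inside) ≡ (weighted r c S - c y) + c x
weighted-swap r c S {x} {y} y∈S x∉S = begin
  r + sumOver (S [ y ]≔ outside [ x ]≔ inside) c ≡⟨ cong (λ z → r + z) (sumOver-insert (S [ y ]≔ outside) x c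
                                                      (trans (lookup∘update′ x≢y S outside) x∉S)) ⟩
  r + (c x + rest)                               ≡⟨ rearrange r (c x) (c y) rest ⟩
  ((r + (c y + rest)) - c y) + c x               ≡⟨ cong (λ z → ((r + z) - c y) + c x) (sym (sumOver-remove S y c y∈S)) ⟩
  (weighted r c S - c y) + c x                   ∎
  where
  open ≡-Reasoning
  rest = sumOver (S [ y ]≔ outside) c
  x≢y : x ≢ y
  x≢y refl with trans (sym y∈S) x∉S
  ... | ()
  rearrange : ∀ r x y z → r + (x + z) ≡ ((r + (y + z)) - y) + x
  rearrange = solve-∀

-- Removing `y` and summing over the n - 3 possible new points gives `A + B * c y`, affine in `c y`.
-- Summing over `y` in `S` leaves θ₁ times the entry plus `+ n * r + + 3 * sum c`, which is 0.
weighted-eigen : ∀ {n} → 4 ℕ.≤ n → ∀ r (c : Fin n → ℤ) → + n * r + + 3 * sum c ≡ 0ℤ → ∀ x →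
                 adjApply n 3 (weighted r c ∘ proj₁) x ≡ theta1 n 3 * weighted r c (proj₁ x)
weighted-eigen {n} 4≤n r c balance (S , ∣S∣≡3) = begin
  adjApply n 3 (F ∘ proj₁) (S , ∣S∣≡3)    ≡⟨ adjApply-swap (F ∘ proj₁) F (λ _ _ → refl) S ∣S∣≡3 ⟩
  swapSum S F                             ≡⟨ sum-cong-≗ inner ⟩
  sumOver S (λ y → A + B * c y)           ≡⟨ sumOver-+ S (λ _ → A) (λ y → B * c y) ⟩
  sumOver S (λ _ → A) + sumOver S (λ y → B * c y) ≡⟨ cong₂ _+_ (sumOver-const S A) (sumOver-*ˡ S B c) ⟩
  + ∣ S ∣ * A + B * s                     ≡⟨ cong (λ m → + m * A + B * s) ∣S∣≡3 ⟩
  + 3 * A + B * s                         ≡⟨ collect N r s C ⟩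
  (+ 2 * N - + 9) * (r + s) + (N * r + + 3 * C) ≡⟨ cong (λ z → (+ 2 * N - + 9) * (r + s) + z) balance ⟩
  (+ 2 * N - + 9) * (r + s) + 0ℤ          ≡⟨ ℤₚ.+-identityʳ _ ⟩
  (+ 2 * N - + 9) * (r + s)               ≡⟨ cong (λ θ → θ * (r + s)) (sym (theta1-value 4≤n)) ⟩
  theta1 n 3 * F S                        ∎
  where
  open ≡-Reasoning
  F = weighted r c
  N = + n
  s = sumOver S c
  C = sum c
  A B : ℤ
  A = (N - + 3) * (r + s) + (C - s)
  B = - (N - + 3)
  collect : ∀ N r s C → + 3 * ((N - + 3) * (r + s) + (C - s)) + - (N - + 3) * s ≡
                        (+ 2 * N - + 9) * (r + s) + (N * r + + 3 * C)
  collect = solve-∀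
  shape : ∀ N r s C y → (N * ((r + s) - y) + C) - (+ 3 * ((r + s) - y) + s) ≡
                        ((N - + 3) * (r + s) + (C - s)) + - (N - + 3) * y
  shape = solve-∀
  inner : ∀ y → when (lookup S y) (sum λ x → when (not (lookup S x)) (F (S [ y ]≔ outside [ x ]≔ inside))) ≡
                when (lookup S y) (A + B * c y)
  inner y with lookup S y in y∈S
  ... | false = refl
  ... | true  = begin
    (sum λ x → when (not (lookup S x)) (F (S [ y ]≔ outside [ x ]≔ inside))) ≡⟨ sum-cong-≗ swapped ⟩
    (sum λ x → when (not (lookup S x)) (a + c x))           ≡⟨ sumOver-outside S (λ x → a + c x) ⟩
    (sum λ x → a + c x) - sumOver S (λ x → a + c x)         ≡⟨ cong₂ _-_ (trans (∑-distrib-+ (λ _ → a) c) (cong (λ z → z + C) (sum-const n a)))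
        (trans (sumOver-+ S (λ _ → a) c) (cong (λ z → z + s) (trans (sumOver-const S a) (cong (λ m → + m * a) ∣S∣≡3)))) ⟩
    (N * a + C) - (+ 3 * a + s)                             ≡⟨ shape N r s C (c y) ⟩
    A + B * c y                                             ∎
    where
    a = F S - c y
    swapped : ∀ x → when (not (lookup S x)) (F (S [ y ]≔ outside [ x ]≔ inside)) ≡ when (not (lookup S x)) (a + c x)
    swapped x with lookup S x in x∉S
    ... | true  = refl
    ... | false = weighted-swap r c S y∈S x∉S

pick : ∀ {n m} (S : Subset n) → ∣ S ∣ ≡ suc m → ∃ λ i → lookup S i ≡ inside × ∣ S [ i ]≔ outside ∣ ≡ m
pick (inside  ∷ S) e = zero , refl , ℕₚ.suc-injective e
pick {m = zero}  (outside ∷ S) e with pick S e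
... | i , i∈S , e′ = suc i , i∈S , e′
pick {m = suc m} (outside ∷ S) e with pick S e
... | i , i∈S , e′ = suc i , i∈S , e′

sumOver-none : ∀ {n} (S : Subset n) f → ∣ S ∣ ≡ 0 → sumOver S f ≡ 0ℤ
sumOver-none []            f _ = refl
sumOver-none (outside ∷ S) f e = trans (ℤₚ.+-identityˡ _) (sumOver-none S (f ∘ suc) e)

removed-≢ : ∀ {n} (S : Subset n) {i j} → lookup (S [ i ]≔ outside) j ≡ inside → i ≢ j
removed-≢ S {i} j∈S refl with trans (sym j∈S) (lookup∘update i S outside)
... | ()

elements : ∀ {n} (S : Subset n) → ∣ S ∣ ≡ 3 → (c : Fin n → ℤ) →
           ∃ λ i → ∃ λ j → ∃ λ k → Distinct i j k × sumOver S c ≡ c i + (c j + c k)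
elements S e c with pick S e
... | i , i∈S , e₁ with pick (S [ i ]≔ outside) e₁
... | j , j∈S , e₂ with pick (S [ i ]≔ outside [ j ]≔ outside) e₂
... | k , k∈S , e₃ = i , j , k , (i≢j , i≢k , removed-≢ (S [ i ]≔ outside) k∈S) , (begin
  sumOver S c                                  ≡⟨ sumOver-remove S i c i∈S ⟩
  c i + sumOver S₁ c                           ≡⟨ cong (λ z → c i + z) (sumOver-remove S₁ j c j∈S) ⟩
  c i + (c j + sumOver S₂ c)                   ≡⟨ cong (λ z → c i + (c j + z)) (sumOver-remove S₂ k c k∈S) ⟩
  c i + (c j + (c k + sumOver (S₂ [ k ]≔ outside) c)) ≡⟨ cong (λ z → c i + (c j + (c k + z))) (sumOver-none (S₂ [ k ]≔ outside) c e₃) ⟩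
  c i + (c j + (c k + 0ℤ))                     ≡⟨ cong (λ z → c i + (c j + z)) (ℤₚ.+-identityʳ (c k)) ⟩
  c i + (c j + c k)                            ∎)
  where
  open ≡-Reasoning
  S₁ = S [ i ]≔ outside
  S₂ = S₁ [ j ]≔ outside
  i≢j : i ≢ j
  i≢j = removed-≢ S j∈S
  i≢k : i ≢ k
  -- Commuting the two removals makes that of `i` the last one.
  i≢k i≡k = removed-≢ (S [ j ]≔ outside)
    (subst (λ U → lookup U k ≡ inside) ([]≔-commutes S i j i≢j) k∈S) i≡k

Fits : ℤ → ℕ → ℤ → Set
Fits r M z = r + z ≢ 0ℤ × ℤ.∣ r + z ∣ ℕ.≤ M

fits? : ∀ r M z → Dec (Fits r M z)
fits? r M z = ¬? (r + z ℤₚ.≟ 0ℤ) ×-dec (ℤ.∣ r + z ∣ ℕ.≤? M)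

Attained : ℕ → ℕ → Set
Attained n m = ∃ λ u → NowhereZero n 3 u × IsEigenvector n 3 (theta1 n 3) u × supNorm n 3 u ℕ.+ 1 ≡ m

weighted-attained : ∀ {n} → 4 ℕ.≤ n → ∀ r (c : Fin n → ℤ) M → + n * r + + 3 * sum c ≡ 0ℤ →
  (∀ {i j k} → Distinct i j k → Fits r M (c i + (c j + c k))) →
  ∀ {i j k} → Distinct i j k → ℤ.∣ r + (c k + (c j + c i)) ∣ ≡ M → Attained n (M ℕ.+ 1)
weighted-attained {n} 4≤n r c M balance fits {i} {j} {k} d extreme =
  u , (λ x → proj₁ (fits-at x)) , ((peak , proj₁ (fits-at peak)) , weighted-eigen 4≤n r c balance) ,
  cong (ℕ._+ 1) (ℕₚ.≤-antisym (supNorm-least u (λ x → proj₂ (fits-at x)))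
    (subst (ℕ._≤ supNorm n 3 u) (trans (cong (λ z → ℤ.∣ r + z ∣) (sumOver-triple c d)) extreme) (supNorm-upper u peak)))
  where
  u : Vertex n 3 → ℤ
  u = weighted r c ∘ proj₁
  peak : Vertex n 3
  peak = triple i j k , ∣triple∣ d
  fits-at : ∀ x → Fits r M (sumOver (proj₁ x) c)
  fits-at (S , p) with elements S p c
  ... | _ , _ , _ , d , e = subst (Fits r M) (sym e) (fits d)

-- Weights with at most three distinct values

blocks : ∀ p {q} → ℤ → ℤ → Fin (p ℕ.+ q) → ℤ
blocks zero    x y i       = y
blocks (suc p) x y zero    = x
blocks (suc p) x y (suc i) = blocks p x y i

sum-blocks : ∀ p q x y → sum (blocks p {q} x y) ≡ + p * x + + q * y
sum-blocks zero    q x y = trans (sum-const q y) (trans (sym (ℤₚ.+-identityˡ _)) (cong (λ z → z + + q * y) (sym (ℤₚ.*-zeroˡ x))))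
sum-blocks (suc p) q x y = trans (cong (λ z → x + z) (sum-blocks p q x y))
  (trans (sym (ℤₚ.+-assoc x (+ p * x) (+ q * y))) (cong (λ z → z + + q * y) (sym (ℤₚ.suc-* (+ p) x))))

blocks-∈ : ∀ p {q} x y (i : Fin (p ℕ.+ q)) → blocks p x y i ∈ x ∷ y ∷ []
blocks-∈ zero    x y i       = there (here refl)
blocks-∈ (suc p) x y zero    = here refl
blocks-∈ (suc p) x y (suc i) = blocks-∈ p x y i

-- With few distinct weights the entries lie in a finite set independent of `n`, so their bounds can
-- be settled by evaluating `allFits?`.
AllFit : ℤ → ℕ → List ℤ → List ℤ → List ℤ → Set
AllFit r M K L N = All (λ x → All (λ y → All (λ z → Fits r M (x + (y + z))) N) L) K

allFit? : ∀ r M K L N → Dec (AllFit r M K L N)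
allFit? r M K L N = all? (λ x → all? (λ y → all? (λ z → fits? r M (x + (y + z))) N) L) K

headed : ∀ {n} → ℤ → (Fin n → ℤ) → Fin (suc n) → ℤ
headed z c zero    = z
headed z c (suc i) = c i

-- `z` is placed at a single index, hence occurs at most once in a triple; only such combinations
-- have to fit. Indices 0, 1, 2 carry z, x, x and form the triple at which the norm `M` is attained.
blocks-attained : ∀ p q r z x y M → let L = x ∷ y ∷ []; n = suc (suc (suc p) ℕ.+ q) in
  1 ℕ.≤ p → + n * r + + 3 * (z + (+ suc (suc p) * x + + q * y)) ≡ 0ℤ →
  AllFit r M L L L × AllFit r M (z ∷ []) L L × AllFit r M L (z ∷ []) L × AllFit r M L L (z ∷ []) →
  ℤ.∣ r + (x + (x + z)) ∣ ≡ M → Attained n (M ℕ.+ 1)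
blocks-attained p q r z x y M 1≤p balance (f , f₁ , f₂ , f₃) extreme =
  weighted-attained (ℕ.s≤s (ℕ.s≤s (ℕ.s≤s (ℕₚ.≤-trans 1≤p (ℕₚ.m≤m+n p q))))) r c M
    (trans (cong (λ s → + n * r + + 3 * (z + s)) (sum-blocks (suc (suc p)) q x y)) balance)
    fits {0F} {1F} {2F} ((λ ()) , (λ ()) , (λ ())) extreme
  where
  n : ℕ
  n = suc (suc (suc p) ℕ.+ q)
  c : Fin n → ℤ
  c = headed z (blocks (suc (suc p)) x y)
  at : ∀ {K L N u v w} → AllFit r M K L N → u ∈ K → v ∈ L → w ∈ N → Fits r M (u + (v + w))
  at f u∈ v∈ w∈ = All.lookup (All.lookup (All.lookup f u∈) v∈) w∈
  m : ∀ i → c (suc i) ∈ x ∷ y ∷ []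
  m = blocks-∈ (suc (suc p)) x y
  fits : ∀ {i j k} → Distinct i j k → Fits r M (c i + (c j + c k))
  fits {zero}  {zero}  {_}     (i≢j , _ , _) = ⊥-elim (i≢j refl)
  fits {zero}  {suc _} {zero}  (_ , i≢k , _) = ⊥-elim (i≢k refl)
  fits {suc _} {zero}  {zero}  (_ , _ , j≢k) = ⊥-elim (j≢k refl)
  fits {zero}  {suc j} {suc k} _ = at f₁ (here refl) (m j) (m k)
  fits {suc i} {zero}  {suc k} _ = at f₂ (m i) (here refl) (m k)
  fits {suc i} {suc j} {zero}  _ = at f₃ (m i) (m j) (here refl)
  fits {suc i} {suc j} {suc k} _ = at f (m i) (m j) (m k)

allFits? : ∀ r M z x y → let L = x ∷ y ∷ [] in
  Dec (AllFit r M L L L × AllFit r M (z ∷ []) L L × AllFit r M L (z ∷ []) L × AllFit r M L L (z ∷ []))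
allFits? r M z x y = allFit? r M L L L ×-dec allFit? r M (z ∷ []) L L ×-dec allFit? r M L (z ∷ []) L ×-dec allFit? r M L L (z ∷ [])
  where
  L = x ∷ y ∷ []

quotient : ∀ n d {r} .{{_ : ℕ.NonZero d}} → n % d ≡ r → n ≡ r ℕ.+ (n ℕ./ d) ℕ.* d
quotient n d e = trans (DM.m≡m%n+[m/n]*n n d) (cong (ℕ._+ (n ℕ./ d) ℕ.* d) e)

-- aᵢ = ±1 in equal numbers.
attained-even : ∀ h → 63 ℕ.< h ℕ.* 2 → Attained (h ℕ.* 2) 4
attained-even 0 h = ⊥-elim (from-no (64 ℕ.≤? 0) h)
attained-even 1 h = ⊥-elim (from-no (64 ℕ.≤? 2) h)
attained-even 2 h = ⊥-elim (from-no (64 ℕ.≤? 4) h)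
attained-even 3 h = ⊥-elim (from-no (64 ℕ.≤? 6) h)
attained-even (suc (suc (suc (suc p)))) _ = subst (λ n → Attained n 4) (count p)
  -- The head weight is simply one of the ones: `4 ℕ.+ p` of each sign.
  (blocks-attained (suc p) (4 ℕ.+ p) 0ℤ 1ℤ 1ℤ -[1+ 0 ] 3 (ℕ.s≤s ℕ.z≤n) (balance (+ p)) (from-yes (allFits? 0ℤ 3 1ℤ 1ℤ -[1+ 0 ])) refl)
  where
  count : ∀ p → suc (suc (suc (suc p)) ℕ.+ (4 ℕ.+ p)) ≡ (4 ℕ.+ p) ℕ.* 2
  count = ℕ-solve-∀
  balance : ∀ p → (+ 4 + p + (+ 4 + p)) * 0ℤ + + 3 * (1ℤ + ((+ 3 + p) * 1ℤ + (+ 4 + p) * -[1+ 0 ])) ≡ 0ℤ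
  balance = solve-∀

-- aᵢ = 4 once, ±1 otherwise.
attained-odd : ∀ h → 63 ℕ.< 1 ℕ.+ h ℕ.* 2 → Attained (1 ℕ.+ h ℕ.* 2) 7
attained-odd 0 h = ⊥-elim (from-no (64 ℕ.≤? 1) h)
attained-odd 1 h = ⊥-elim (from-no (64 ℕ.≤? 3) h)
attained-odd 2 h = ⊥-elim (from-no (64 ℕ.≤? 5) h)
attained-odd 3 h = ⊥-elim (from-no (64 ℕ.≤? 7) h)
attained-odd 4 h = ⊥-elim (from-no (64 ℕ.≤? 9) h)
attained-odd (suc (suc (suc (suc (suc p))))) _ = subst (λ n → Attained n 7) (count p)
  -- 3 + p ones against 7 + p minus ones balance the 4; entries containing the 4 lie between 2 and
  -- 6, all others are odd.
  (blocks-attained (suc p) (7 ℕ.+ p) 0ℤ (+ 4) 1ℤ -[1+ 0 ] 6 (ℕ.s≤s ℕ.z≤n) (balance (+ p)) (from-yes (allFits? 0ℤ 6 (+ 4) 1ℤ -[1+ 0 ])) refl)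
  where
  count : ∀ p → suc (suc (suc (suc p)) ℕ.+ (7 ℕ.+ p)) ≡ 1 ℕ.+ (5 ℕ.+ p) ℕ.* 2
  count = ℕ-solve-∀
  balance : ∀ p → (+ 4 + p + (+ 7 + p)) * 0ℤ + + 3 * (+ 4 + ((+ 3 + p) * 1ℤ + (+ 7 + p) * -[1+ 0 ])) ≡ 0ℤ
  balance = solve-∀

-- aᵢ = -5/3 for 4 k indices and 4/3 for 5 k indices.
attained-9k : ∀ k → 63 ℕ.< k ℕ.* 9 → Attained (k ℕ.* 9) 6
attained-9k 0 h = ⊥-elim (from-no (64 ℕ.≤? 0) h)
attained-9k (suc k) _ = subst (λ n → Attained n 6) (count k)
  -- With `r` equal to 1, the weights -2 and 1 stand for -5/3 and 4/3; the head weight is one of the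
  -- -2.
  (blocks-attained (1 ℕ.+ (k ℕ.+ k ℕ.+ k ℕ.+ k)) (5 ℕ.+ (k ℕ.+ k ℕ.+ k ℕ.+ k ℕ.+ k)) 1ℤ -[1+ 1 ] -[1+ 1 ] 1ℤ 5 (ℕ.s≤s ℕ.z≤n)
    (balance (+ k)) (from-yes (allFits? 1ℤ 5 -[1+ 1 ] -[1+ 1 ] 1ℤ)) refl)
  where
  count : ∀ k → suc (suc (suc (1 ℕ.+ (k ℕ.+ k ℕ.+ k ℕ.+ k))) ℕ.+ (5 ℕ.+ (k ℕ.+ k ℕ.+ k ℕ.+ k ℕ.+ k))) ≡ (1 ℕ.+ k) ℕ.* 9
  count = ℕ-solve-∀
  balance : ∀ k → (+ 4 + (k + k + k + k) + (+ 5 + (k + k + k + k + k))) * 1ℤ +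
                  + 3 * (-[1+ 1 ] + ((+ 3 + (k + k + k + k)) * -[1+ 1 ] + (+ 5 + (k + k + k + k + k)) * 1ℤ)) ≡ 0ℤ
  balance = solve-∀

-- aᵢ = 7/3 once, -5/3 for 4 k + 3 indices and 4/3 for 5 k + 2 indices.
attained-9k+6 : ∀ k → 63 ℕ.< 6 ℕ.+ k ℕ.* 9 → Attained (6 ℕ.+ k ℕ.* 9) 6
attained-9k+6 0 h = ⊥-elim (from-no (64 ℕ.≤? 6) h)
attained-9k+6 (suc k) _ = subst (λ n → Attained n 6) (count k)
  (blocks-attained (5 ℕ.+ (k ℕ.+ k ℕ.+ k ℕ.+ k ℕ.+ k)) (7 ℕ.+ (k ℕ.+ k ℕ.+ k ℕ.+ k)) 1ℤ (+ 2) 1ℤ -[1+ 1 ] 5 (ℕ.s≤s ℕ.z≤n)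
    (balance (+ k)) (from-yes (allFits? 1ℤ 5 (+ 2) 1ℤ -[1+ 1 ])) refl)
  where
  count : ∀ k → suc (suc (suc (5 ℕ.+ (k ℕ.+ k ℕ.+ k ℕ.+ k ℕ.+ k))) ℕ.+ (7 ℕ.+ (k ℕ.+ k ℕ.+ k ℕ.+ k))) ≡ 6 ℕ.+ (1 ℕ.+ k) ℕ.* 9
  count = ℕ-solve-∀
  balance : ∀ k → (+ 8 + (k + k + k + k + k) + (+ 7 + (k + k + k + k))) * 1ℤ +
                  + 3 * (+ 2 + ((+ 7 + (k + k + k + k + k)) * 1ℤ + (+ 7 + (k + k + k + k)) * -[1+ 1 ])) ≡ 0ℤ
  balance = solve-∀

-- Residues of n and the two bounds

odd-quotient : ∀ n → n % 2 ≢ 0 → n % 2 ≡ 1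
odd-quotient n n-odd with n % 2 | DM.m%n<n n 2
... | 0 | _ = ⊥-elim (n-odd refl)
... | 1 | _ = refl
... | suc (suc _) | ℕ.s≤s (ℕ.s≤s ())

attained-by-residue : ∀ {m} d r {n} .{{_ : ℕ.NonZero d}} → 63 ℕ.< n → n % d ≡ r →
  (∀ k → 63 ℕ.< r ℕ.+ k ℕ.* d → Attained (r ℕ.+ k ℕ.* d) m) → Attained n m
attained-by-residue {m} d r {n} 63<n e attained = subst (λ n → Attained n m) (sym n≡)
  (attained (n ℕ./ d) (subst (63 ℕ.<_) n≡ 63<n))
  where
  n≡ : n ≡ r ℕ.+ (n ℕ./ d) ℕ.* d
  n≡ = quotient n d e

LowerBound : ℕ → ℕ → Set
LowerBound n m = ∀ u → NowhereZero n 3 u → IsEigenvector n 3 (theta1 n 3) u → m ℕ.≤ supNorm n 3 u ℕ.+ 1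

-- A norm above 5 is at least 6 and so meets every bound `m ℕ.≤ 6`; only norms up to 5 call for the
-- structure of heavy values.
lowerBound-small : ∀ {n m} → m ℕ.≤ 6 →
  (∀ u → NowhereZero n 3 u → IsEigenvector n 3 (theta1 n 3) u → supNorm n 3 u ℕ.≤ 5 → m ℕ.≤ supNorm n 3 u) →
  LowerBound n (m ℕ.+ 1)
lowerBound-small {n} {m} m≤6 small u nz ev = ℕₚ.+-monoˡ-≤ 1 (cases (ℕₚ.≤-<-connex (supNorm n 3 u) 5))
  where
  cases : supNorm n 3 u ℕ.≤ 5 ⊎ 5 ℕ.< supNorm n 3 u → m ℕ.≤ supNorm n 3 u
  cases (inj₁ ≤5) = small u nz ev ≤5
  cases (inj₂ >5) = ℕₚ.≤-trans m≤6 >5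

lowerBound-even : ∀ {n} → 63 ℕ.< n → LowerBound n 4
lowerBound-even 63<n = lowerBound-small (ℕₚ.m≤m+n 3 3) λ u nz ev ≤5 → proj₁ (sup-constraints 63<n u nz ev ≤5)

lowerBound-odd : ∀ {n} → 63 ℕ.< n → n % 2 ≢ 0 → LowerBound n 6
lowerBound-odd 63<n odd = lowerBound-small (ℕₚ.m≤m+n 5 1) λ u nz ev ≤5 → proj₁ (proj₂ (sup-constraints 63<n u nz ev ≤5) odd)

lowerBound-other : ∀ {n} → 63 ℕ.< n → n % 2 ≢ 0 → n % 9 ≢ 0 → n % 9 ≢ 6 → LowerBound n 7
lowerBound-other 63<n odd ≢0 ≢6 = lowerBound-small ℕₚ.≤-refl λ u nz ev ≤5 →
  ⊥-elim ([ ≢0 , ≢6 ]′ (proj₂ (proj₂ (sup-constraints 63<n u nz ev ≤5) odd)))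

-- Indexing by the value of `expectedM` keeps the outcomes of its tests as proofs to match on.
data Residue (n : ℕ) : ℕ → Set where
  even  : n % 2 ≡ 0 → Residue n 4
  odd   : n % 2 ≢ 0 → n % 9 ≡ 0 ⊎ n % 9 ≡ 6 → Residue n 6
  other : n % 2 ≢ 0 → n % 9 ≢ 0 → n % 9 ≢ 6 → Residue n 7

expectedM-residue : ∀ n → Residue n (expectedM n)
expectedM-residue n with n % 2 ℕ.≟ 0
... | yes ≡0 = even ≡0
... | no  ≢0 with n % 9 ℕ.≟ 0 | n % 9 ℕ.≟ 6
...   | yes e | _     = odd ≢0 (inj₁ e)
...   | no _  | yes e = odd ≢0 (inj₂ e)
...   | no e  | no f  = other ≢0 e f

M1-residue : ∀ {n m} → 63 ℕ.< n → Residue n m → M1Is n 3 m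
M1-residue 63<n (even ≡0)          = attained-by-residue 2 0 63<n ≡0 attained-even , lowerBound-even 63<n
M1-residue 63<n (odd ≢0 (inj₁ e))  = attained-by-residue 9 0 63<n e attained-9k , lowerBound-odd 63<n ≢0
M1-residue 63<n (odd ≢0 (inj₂ e))  = attained-by-residue 9 6 63<n e attained-9k+6 , lowerBound-odd 63<n ≢0
M1-residue {n} 63<n (other ≢0 e f) =
  attained-by-residue 2 1 63<n (odd-quotient n ≢0) attained-odd , lowerBound-other 63<n ≢0 e f

theorem5 : (n : ℕ) → 63 < n → M1Is n 3 (expectedM n)
theorem5 n 63<n = M1-residue 63<n (expectedM-residue n)
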